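{- There is an absolute constant $C>0$ such that for all positive integers $n$ and $t$ with $t\ge 2$: there exists an edge-ordered graph on at most $2^{Cnt(\log_2 n)(\log_2 t)}$ vertices that is Ramsey $\mathcal{F}_{n,t}$ universal; and $r_{\text{edge}}(H_1,H_2)\le 2^{Cnt(\log_2 n)(\log_2 t)}$ for all $H_1\in\mathcal{F}_n$ and $H_2\in\mathcal{F}_{n,t}$.
   Context: An edge-ordered graph is a finite simple graph together with a total ordering of its edges. Two edge-ordered graphs are equivalent if there is a graph isomorphism between them preserving the ordering of the edges; a copy of $H$ in $G$ is a subgraph of $G$ (with inherited edge-ordering) equivalent to $H$. $\mathcal{F}_n$ is the family of all edge-ordered graphs on $n$ vertices and $\mathcal{F}_{n,t}$ the family of all edge-ordered graphs on $n$ vertices with chromatic number at most $t$. Given a family $\mathcal{F}$ of edge-ordered graphs, an edge-ordered graph $G$ is Ramsey $\mathcal{F}$ universal if for every two-coloring of the edges of $G$ there exists a monochromatic subgraph of $G$ containing a copy of every edge-ordered graph in $\mathcal{F}$. For edge-ordered graphs $H_1,H_2$, $r_{\text{edge}}(H_1,H_2)$ is the smallest $N$ such that there exists an edge-ordered graph $G$ on $N$ vertices such that every red-blue coloring of the edges of $G$ contains either a red copy of $H_1$ or a blue copy of $H_2$. -}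

module Defs where

open import Data.Nat using (ℕ; zero; suc; _+_; _*_; _^_; _≤_; _<_)
open import Data.Fin using (Fin)
open import Data.Bool using (Bool; true; false)
open import Data.Product using (Σ; ∃; ∃-syntax; _×_; _,_)
open import Data.Sum using (_⊎_)
open import Relation.Binary.PropositionalEquality using (_≡_; _≢_)
open import Function.Definitions using (Injective)

-- An edge-ordered graph on the vertex set Fin N: a finite simple graph
-- (symmetric, irreflexive adjacency) together with a total ordering of its
-- edges, given by an injective labelling of edges by natural numbers
-- (edge e comes before edge f iff label e < label f).
record EOGraph (N : ℕ) : Set where
  field
    adj       : Fin N → Fin N → Bool
    adj-irr   : ∀ v → adj v v ≡ false
    adj-sym   : ∀ u v → adj u v ≡ adj v u
    label     : Fin N → Fin N → ℕ
    label-sym : ∀ u v → label u v ≡ label v u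
    label-inj : ∀ u v x y → adj u v ≡ true → adj x y ≡ true →
                label u v ≡ label x y →
                (u ≡ x × v ≡ y) ⊎ (u ≡ y × v ≡ x)

open EOGraph public

-- A two-colouring of the edges of G (true = red, false = blue); it is a
-- symmetric function on vertex pairs, only its values on edges matter.
record Colouring {N : ℕ} (G : EOGraph N) : Set where
  field
    col     : Fin N → Fin N → Bool
    col-sym : ∀ u v → col u v ≡ col v u

open Colouring public

-- A copy of H in G all of whose edges have colour c under χ:
-- an injective vertex map sending edges of H to edges of G of colour c,
-- preserving the edge ordering (the image subgraph with the inherited
-- ordering is then equivalent to H).
record MonoCopy {n N : ℕ} (H : EOGraph n) (G : EOGraph N)
                (χ : Colouring G) (c : Bool) : Set where
  field
    f        : Fin n → Fin N
    f-inj    : Injective _≡_ _≡_ f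
    f-edge   : ∀ u v → adj H u v ≡ true → adj G (f u) (f v) ≡ true
    f-colour : ∀ u v → adj H u v ≡ true → col χ (f u) (f v) ≡ c
    f-order  : ∀ u v x y → adj H u v ≡ true → adj H x y ≡ true →
               label H u v < label H x y →
               label G (f u) (f v) < label G (f x) (f y)

ChromaticAtMost : {n : ℕ} → EOGraph n → ℕ → Set
ChromaticAtMost {n} H t =
  Σ (Fin n → Fin t) λ κ → ∀ u v → adj H u v ≡ true → κ u ≢ κ v

-- The family F_{n,t}, as a predicate on edge-ordered graphs on n vertices.
-- (F_n is all of EOGraph n.)
F : (n t : ℕ) → EOGraph n → Set
F n t H = ChromaticAtMost H t

RamseyUniversal : {N : ℕ} → EOGraph N → (n : ℕ) → (EOGraph n → Set) → Set
RamseyUniversal G n P =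
  (χ : Colouring G) → Σ Bool λ c → (H : EOGraph n) → P H → MonoCopy H G χ c

Arrows : {N n₁ n₂ : ℕ} → EOGraph N → EOGraph n₁ → EOGraph n₂ → Set
Arrows G H₁ H₂ =
  (χ : Colouring G) → MonoCopy H₁ G χ true ⊎ MonoCopy H₂ G χ false

RedgeAtMost : {n₁ n₂ : ℕ} → EOGraph n₁ → EOGraph n₂ → (B : ℕ) → Set
RedgeAtMost H₁ H₂ B = ∃[ N ] (N ≤ B × Σ (EOGraph N) λ G → Arrows G H₁ H₂)

-- BoundedBy K n t N  expresses exactly the real inequality
--     N ≤ 2^(K · log₂ n · log₂ t)       (for n ≥ 1, t ≥ 2),
-- i.e. log₂ N ≤ K · log₂ n · log₂ t, via rational approximation:
-- for all naturals p, q with q > 0: if n^p < N^q (i.e. p·log₂ n < q·log₂ N)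
-- then 2^p < t^(K·q) (i.e. p < q·K·log₂ t).
BoundedBy : (K n t N : ℕ) → Set
BoundedBy K n t N =
  ∀ (p q : ℕ) → 0 < q → n ^ p < N ^ q → 2 ^ p < t ^ (K * q)

{-# OPTIONS --safe #-}
-- The host is a complete graph whose edges carry one of M coarse labels, refined to a total order.
-- The labels come from the pairing a a′ + b + b′ over a finite field of characteristic 2, so for
-- every vertex set R all but few vertices see each label on close to |R| / M vertices of R.
--
-- Suppose that some ordered pattern has no red copy.  Embedding it greedily, with the edge of rank i
-- placed in the i-th of m windows of labels, must get stuck, and then in one of these windows almost
-- no edge between two large sets A and B is red.  Iterating this inside A, and then inside the
-- vertices of B with few red edges to the sets found in A, always within the window found so far,
-- yields 2ᵏ > t large sets, pairwise sparse in red for a common window of m labels.  This costs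
-- 2ᵏ - 1 nested windows, hence M = m ^ 2ᵏ.  Between these sets every t-chromatic ordered pattern is
-- embedded greedily in blue, last set first, so that the chosen vertex always has few red
-- neighbours in the sets still to be used.
module Submission where

open import Defs
open import Data.Nat renaming (_≟_ to _≟ℕ_)
open import Data.Nat.Properties hiding (_≟_)
open import Data.Nat.Tactic.RingSolver using (solve-∀)
open import Data.Nat.DivMod using (m/n*n≤m; m*n/n≡m; /-monoˡ-≤)
open import Data.Fin using (Fin; zero; suc; toℕ; fromℕ<; _↑ˡ_; _↑ʳ_; combine; remQuot; punchIn; punchOut)
  renaming (_<_ to _<ᶠ_)
open import Data.Fin.Properties using (_≟_; any?; all?; ¬∀⟶∃¬; toℕ<n; toℕ-fromℕ<; toℕ-injective;
  remQuot-combine; combine-remQuot; combine-injective; combine-monoˡ-<; punchIn-punchOut)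
  renaming (<-cmp to <ᶠ-cmp; _<?_ to _<ᶠ?_; _≤?_ to _≤ᶠ?_; ≤-antisym to ≤ᶠ-antisym)
open import Data.Fin.Permutation using (permutation)
open import Data.Bool using (Bool; true; false; _∧_; _∨_; not)
  renaming (_≟_ to _≟ᵇ_; _xor_ to _⊻_)
open import Data.Product using (Σ; ∃; ∃₂; ∃-syntax; _×_; _,_; proj₁; proj₂) renaming (swap to swapˣ)
open import Data.Sum using (_⊎_; inj₁; inj₂; [_,_]′)
open import Data.Empty using (⊥-elim)
open import Data.Vec using (Vec; lookup; tabulate; []; _∷_)
open import Data.Vec.Properties using (lookup∘tabulate)
open import Relation.Nullary using (¬_; Dec; yes; no; contradiction)
open import Relation.Nullary.Decidable using (⌊_⌋; _×-dec_; _→-dec_; ¬?)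
open import Relation.Binary.Definitions using (tri<; tri≈; tri>)
open import Relation.Binary.PropositionalEquality
  using (_≡_; _≢_; refl; sym; trans; cong; cong₂; subst; subst₂; module ≡-Reasoning)
open import Function using (id; case_of_)
open import Algebra.Bundles using (CommutativeRing; CommutativeSemiring)
open import Algebra.Structures using (IsCommutativeSemiring)
import Algebra.Solver.Ring.NaturalCoefficients.Default as SemiringSolver
open import Data.Bool.Properties using (xor-∧-commutativeRing)
open import Relation.Binary.PropositionalEquality.Properties using () renaming (isEquivalence to ≡-isEquivalence)
open import Algebra.Properties.Semiring.Sum +-*-semiring
  using (sum; sum-cong-≗; ∑-distrib-+; ∑-comm; sum-permute; *-distribˡ-sum; *-distribʳ-sum)

-- Sparse has to mean a density well below 1 / M. The vertices seen under one prescribed label are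
-- only about a 1 / M fraction of a set, and a denser red neighbourhood could contain all of them.
-- This is why the sparseness parameter `E` is a power of M, namely M⁴. The blue embedding must also
-- keep red degrees shrinking in step with the candidate sets. Red neighbourhoods are chosen by the
-- colouring, so the labels have to be regular on every vertex set. The second moment bound gives
-- this for an arbitrary set R. Applied to the red neighbourhoods of all later candidates u at once
-- and averaged over u, it yields a vertex that is typical for all but few u, and those few are
-- deleted. Once a window is found nothing is known about red outside it, so windows can only be
-- refined. The number of subdivisions is therefore linear in t, and log M is of order t log n. The
-- set sizes lose a factor of about Eⁿ at each of the log t levels of the recursion, so log N is of
-- order n log t log M.

-- Finite sets and counting.

Subset : ℕ → Set
Subset N = Fin N → Bool

⟦_⟧ : Bool → ℕ
⟦ true ⟧  = 1
⟦ false ⟧ = 0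

-- Opaque, so that the unifier can read the subset off its cardinality.
opaque
  # : ∀ {N} → Subset N → ℕ
  # P = sum (λ i → ⟦ P i ⟧)

  #-sum : ∀ {N} (P : Subset N) → # P ≡ sum (λ i → ⟦ P i ⟧)
  #-sum P = refl

infixr 6 _∩_

_∩_ : ∀ {N} → Subset N → Subset N → Subset N
(P ∩ R) i = P i ∧ R i

infix 4 _∈ˢ_ _⊆ˢ_

_∈ˢ_ : ∀ {N} → Fin N → Subset N → Set
i ∈ˢ P = P i ≡ true

_⊆ˢ_ : ∀ {N} → Subset N → Subset N → Set
P ⊆ˢ R = ∀ {i} → i ∈ˢ P → i ∈ˢ R

∧-split : ∀ {x y} → x ∧ y ≡ true → x ≡ true × y ≡ true
∧-split {true} {true} _ = refl , refl

∧-join : ∀ {x y} → x ≡ true → y ≡ true → x ∧ y ≡ true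
∧-join refl refl = refl

not-true : ∀ {x} → not x ≡ true → x ≡ false
not-true {false} _ = refl

⌊⌋-true : ∀ {a} {A : Set a} (d : Dec A) → ⌊ d ⌋ ≡ true → A
⌊⌋-true (yes a) _ = a

true-⌊⌋ : ∀ {a} {A : Set a} (d : Dec A) → A → ⌊ d ⌋ ≡ true
true-⌊⌋ (yes _) _ = refl
true-⌊⌋ (no ¬a) a = contradiction a ¬a

false-⌊⌋ : ∀ {a} {A : Set a} (d : Dec A) → ¬ A → ⌊ d ⌋ ≡ false
false-⌊⌋ (yes a) ¬a = contradiction a ¬a
false-⌊⌋ (no _) _ = refl

⌊⌋-false : ∀ {a} {A : Set a} (d : Dec A) → ⌊ d ⌋ ≡ false → ¬ A
⌊⌋-false (no ¬a) _ = ¬a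

⟦⟧≤1 : ∀ x → ⟦ x ⟧ ≤ 1
⟦⟧≤1 true  = ≤-refl
⟦⟧≤1 false = z≤n

⟦∧⟧ : ∀ x y → ⟦ x ∧ y ⟧ ≡ ⟦ x ⟧ * ⟦ y ⟧
⟦∧⟧ true  y = sym (*-identityˡ _)
⟦∧⟧ false y = refl

sum-mono : ∀ {n} {f g : Fin n → ℕ} → (∀ i → f i ≤ g i) → sum f ≤ sum g
sum-mono {zero}  f≤g = z≤n
sum-mono {suc n} f≤g = +-mono-≤ (f≤g zero) (sum-mono (λ i → f≤g (suc i)))

sum-const : ∀ n c → sum {n} (λ _ → c) ≡ n * c
sum-const zero    c = refl
sum-const (suc n) c = cong (c +_) (sum-const n c)

sum-≤-const : ∀ {n} {f : Fin n → ℕ} c → (∀ i → f i ≤ c) → sum f ≤ n * c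
sum-≤-const {n} c f≤c = ≤-trans (sum-mono f≤c) (≤-reflexive (sum-const n c))

term≤sum : ∀ {n} (f : Fin n → ℕ) i → f i ≤ sum f
term≤sum {suc n} f zero    = m≤m+n _ _
term≤sum {suc n} f (suc i) = ≤-trans (term≤sum (λ j → f (suc j)) i) (m≤n+m _ _)

sum-* : ∀ {m n} (f : Fin m → ℕ) (g : Fin n → ℕ) →
        sum (λ i → sum (λ j → f i * g j)) ≡ sum f * sum g
sum-* f g = begin
  sum (λ i → sum (λ j → f i * g j)) ≡⟨ sum-cong-≗ (λ i → *-distribˡ-sum (f i) g) ⟨
  sum (λ i → f i * sum g)           ≡⟨ *-distribʳ-sum (sum g) f ⟨
  sum f * sum g                     ∎
  where open ≡-Reasoning

sum-δ : ∀ {n} (c : Fin n) → sum (λ i → ⟦ ⌊ i ≟ c ⌋ ⟧) ≡ 1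
sum-δ {suc n} zero    = cong suc (trans (sum-const n 0) (*-zeroʳ n))
sum-δ {suc n} (suc c) = trans (sum-cong-≗ shift) (sum-δ c)
  where
  shift : ∀ i → ⟦ ⌊ Fin.suc i ≟ suc c ⌋ ⟧ ≡ ⟦ ⌊ i ≟ c ⌋ ⟧
  shift i with i ≟ c
  ... | yes _ = refl
  ... | no _  = refl

sum-++ : ∀ m {n} (f : Fin (m + n) → ℕ) →
         sum f ≡ sum (λ i → f (i ↑ˡ n)) + sum (λ j → f (m ↑ʳ j))
sum-++ zero    f = refl
sum-++ (suc m) {n} f = trans (cong (f zero +_) (sum-++ m (λ i → f (suc i))))
  (sym (+-assoc (f zero) (sum (λ i → f (suc (i ↑ˡ n)))) (sum (λ j → f (suc m ↑ʳ j)))))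

sum-combine : ∀ m n (f : Fin (m * n) → ℕ) →
              sum f ≡ sum (λ i → sum (λ j → f (combine {m} {n} i j)))
sum-combine zero    n f = refl
sum-combine (suc m) n f = trans (sum-++ n f) (cong (sum (λ i → f (i ↑ˡ m * n)) +_) (sum-combine m n (λ i → f (n ↑ʳ i))))

sum-remQuot : ∀ m n (F : Fin m × Fin n → ℕ) →
              sum (λ v → F (remQuot {m} n v)) ≡ sum (λ i → sum (λ k → F (i , k)))
sum-remQuot m n F = trans (sum-combine m n (λ v → F (remQuot {m} n v)))
  (sum-cong-≗ (λ i → sum-cong-≗ (λ k → cong F (remQuot-combine {m} {n} i k))))

#-mono : ∀ {N} {P R : Subset N} → P ⊆ˢ R → # P ≤ # R
#-mono {N} {P} {R} P⊆R = subst₂ _≤_ (sym (#-sum P)) (sym (#-sum R)) (sum-mono go)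
  where
  go : ∀ i → ⟦ P i ⟧ ≤ ⟦ R i ⟧
  go i with P i in eq
  ... | false = z≤n
  ... | true  rewrite P⊆R eq = ≤-refl

#-none : ∀ {N} {P : Subset N} → (∀ i → P i ≡ false) → # P ≡ 0
#-none {N} {P} none = begin
  # P                   ≡⟨ #-sum P ⟩
  sum (λ i → ⟦ P i ⟧)   ≡⟨ sum-cong-≗ (λ i → cong ⟦_⟧ (none i)) ⟩
  sum {N} (λ _ → 0)     ≡⟨ sum-const N 0 ⟩
  N * 0                 ≡⟨ *-zeroʳ N ⟩
  0                     ∎
  where open ≡-Reasoning

#≤N : ∀ {N} (P : Subset N) → # P ≤ N
#≤N {N} P = begin
  # P                  ≡⟨ #-sum P ⟩
  sum (λ i → ⟦ P i ⟧)  ≤⟨ sum-≤-const 1 (λ i → ⟦⟧≤1 (P i)) ⟩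
  N * 1                ≡⟨ *-identityʳ N ⟩
  N                    ∎
  where open ≤-Reasoning

#-swap : ∀ {M N} (R : Fin M → Fin N → Bool) → sum (λ i → # (R i)) ≡ sum (λ j → # (λ i → R i j))
#-swap R = begin
  sum (λ i → # (R i))                 ≡⟨ sum-cong-≗ (λ i → #-sum (R i)) ⟩
  sum (λ i → sum (λ j → ⟦ R i j ⟧))   ≡⟨ ∑-comm (λ i j → ⟦ R i j ⟧) ⟩
  sum (λ j → sum (λ i → ⟦ R i j ⟧))   ≡⟨ sum-cong-≗ (λ j → #-sum (λ i → R i j)) ⟨
  sum (λ j → # (λ i → R i j))         ∎
  where open ≡-Reasoning

#-cover : ∀ {N n} {P : Subset N} (U : Fin n → Subset N) →
          (∀ {i} → i ∈ˢ P → ∃[ b ] i ∈ˢ U b) → # P ≤ sum (λ b → # (U b))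
#-cover {N} {n} {P} U cov = begin
  # P                               ≡⟨ #-sum P ⟩
  sum (λ i → ⟦ P i ⟧)               ≤⟨ sum-mono go ⟩
  sum (λ i → # (λ b → U b i))       ≡⟨ #-swap (λ i b → U b i) ⟩
  sum (λ b → # (U b))               ∎
  where
  open ≤-Reasoning
  go : ∀ i → ⟦ P i ⟧ ≤ # (λ b → U b i)
  go i with P i in eq
  ... | false = z≤n
  ... | true  with cov eq
  ...   | b , Ub = begin
    1                              ≡⟨ cong ⟦_⟧ (sym Ub) ⟩
    ⟦ U b i ⟧                      ≤⟨ term≤sum (λ b → ⟦ U b i ⟧) b ⟩
    sum (λ b → ⟦ U b i ⟧)          ≡⟨ #-sum (λ b → U b i) ⟨
    # (λ b → U b i)                ∎

#-union : ∀ {N} {P R S : Subset N} → (∀ {i} → i ∈ˢ P → i ∈ˢ R ⊎ i ∈ˢ S) → # P ≤ # R + # S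
#-union {N} {P} {R} {S} cov = begin
  # P                                            ≡⟨ #-sum P ⟩
  sum (λ i → ⟦ P i ⟧)                            ≤⟨ sum-mono go ⟩
  sum (λ i → ⟦ R i ⟧ + ⟦ S i ⟧)                  ≡⟨ ∑-distrib-+ (λ i → ⟦ R i ⟧) (λ i → ⟦ S i ⟧) ⟩
  sum (λ i → ⟦ R i ⟧) + sum (λ i → ⟦ S i ⟧)      ≡⟨ cong₂ _+_ (#-sum R) (#-sum S) ⟨
  # R + # S                                      ∎
  where
  open ≤-Reasoning
  go : ∀ i → ⟦ P i ⟧ ≤ ⟦ R i ⟧ + ⟦ S i ⟧
  go i with P i in eq
  ... | false = z≤n
  ... | true  with cov eq
  ...   | inj₁ r = ≤-trans (≤-reflexive (cong ⟦_⟧ (sym r))) (m≤m+n _ _)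
  ...   | inj₂ s = ≤-trans (≤-reflexive (cong ⟦_⟧ (sym s))) (m≤n+m _ _)

#-pick : ∀ {N} (P B : Subset N) → # B < # P → ∃[ i ] (i ∈ˢ P × B i ≡ false)
#-pick P B B<P with any? (λ i → (P i ≟ᵇ true) ×-dec (B i ≟ᵇ false))
... | yes found = found
... | no none   = contradiction (#-mono P⊆B) (<⇒≱ B<P)
  where
  P⊆B : P ⊆ˢ B
  P⊆B {i} p with B i in eq
  ... | true  = refl
  ... | false = contradiction (i , p , eq) none

#-inhabited : ∀ {N} (P : Subset N) → 0 < # P → ∃[ i ] i ∈ˢ P
#-inhabited P 0<P with #-pick P (λ _ → false) (subst (_< # P) (sym (#-none {P = λ _ → false} (λ _ → refl))) 0<P)
... | i , p , _ = i , p

#-pigeonhole : ∀ {N n} {P : Subset N} (U : Fin n → Subset N) → 0 < # P →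
               (∀ {i} → i ∈ˢ P → ∃[ b ] i ∈ˢ U b) → ∃[ b ] # P ≤ n * # (U b)
#-pigeonhole {N} {n} {P} U 0<P cov with any? (λ b → # P ≤? n * # (U b))
... | yes found = found
... | no none   = ⊥-elim (<-irrefl refl (begin-strict
  n * # P                        ≤⟨ *-monoʳ-≤ n (#-cover U cov) ⟩
  n * sum (λ b → # (U b))        ≡⟨ *-distribˡ-sum n (λ b → # (U b)) ⟩
  sum (λ b → n * # (U b))        <⟨ below n _ 0<n (λ b → ≰⇒> (λ le → none (b , le))) ⟩
  n * # P                        ∎))
  where
  open ≤-Reasoning
  below : ∀ k (f : Fin k → ℕ) → 0 < k → (∀ b → f b < # P) → sum f < k * # P
  below (suc zero)    f _ lt = +-monoˡ-< 0 (lt zero)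
  below (suc (suc k)) f _ lt = +-mono-< (lt zero) (below (suc k) (λ b → f (suc b)) z<s (λ b → lt (suc b)))
  0<n : 0 < n
  0<n with #-inhabited P 0<P
  ... | i , p = ≤-trans (s≤s z≤n) (toℕ<n (proj₁ (cov p)))

markov : ∀ {N} (f : Fin N → ℕ) (c : ℕ) → # (λ i → ⌊ c <? f i ⌋) * c ≤ sum f
markov f c = begin
  # (λ i → ⌊ c <? f i ⌋) * c               ≡⟨ cong (_* c) (#-sum (λ i → ⌊ c <? f i ⌋)) ⟩
  sum (λ i → ⟦ ⌊ c <? f i ⌋ ⟧) * c         ≡⟨ *-distribʳ-sum c (λ i → ⟦ ⌊ c <? f i ⌋ ⟧) ⟩
  sum (λ i → ⟦ ⌊ c <? f i ⌋ ⟧ * c)         ≤⟨ sum-mono go ⟩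
  sum f                                    ∎
  where
  open ≤-Reasoning
  go : ∀ i → ⟦ ⌊ c <? f i ⌋ ⟧ * c ≤ f i
  go i with c <? f i
  ... | yes c<f = ≤-trans (≤-reflexive (+-identityʳ c)) (<⇒≤ c<f)
  ... | no _    = z≤n

-- A tower of quadratic extensions of the field with two elements.

-- Negation is the identity in characteristic 2, so `x⊕x≡𝟎` replaces it, the other laws are those of
-- a semiring, and polynomial identities go through the semiring solver. The numbering by `to` and
-- `from` makes field elements usable as indices of sums.
record CharTwoField : Set₁ where
  infixl 6 _⊕_
  infixl 7 _⊗_
  field
    Carrier : Set
    _⊕_ _⊗_ : Carrier → Carrier → Carrier
    𝟎 𝟏     : Carrier
    isCommutativeSemiring : IsCommutativeSemiring _≡_ _⊕_ _⊗_ 𝟎 𝟏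
    x⊕x≡𝟎   : ∀ x → x ⊕ x ≡ 𝟎
    inverse : ∀ x → x ≢ 𝟎 → ∃[ y ] x ⊗ y ≡ 𝟏
    -- z² + z + θ is irreducible, which makes a quadratic extension available.
    θ       : Carrier
    θ-irr   : ∀ y → y ⊗ y ⊕ y ≢ θ
    size    : ℕ
    to      : Carrier → Fin size
    from    : Fin size → Carrier
    to-from : ∀ i → to (from i) ≡ i
    from-to : ∀ x → from (to x) ≡ x

  commutativeSemiring : CommutativeSemiring _ _
  commutativeSemiring = record { isCommutativeSemiring = isCommutativeSemiring }

  open IsCommutativeSemiring isCommutativeSemiring public
    using (zeroˡ; zeroʳ; distribʳ)
    renaming ( +-identityˡ to ⊕-identityˡ; +-identityʳ to ⊕-identityʳ; +-comm to ⊕-comm; +-assoc to ⊕-assoc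
             ; *-identityˡ to ⊗-identityˡ; *-identityʳ to ⊗-identityʳ; *-comm to ⊗-comm; *-assoc to ⊗-assoc )

  to-injective : ∀ {x y} → to x ≡ to y → x ≡ y
  to-injective {x} {y} eq = trans (sym (from-to x)) (trans (cong from eq) (from-to y))

  _≟ᴷ_ : (x y : Carrier) → Dec (x ≡ y)
  x ≟ᴷ y with to x ≟ to y
  ... | yes eq = yes (to-injective eq)
  ... | no neq = no (λ eq → neq (cong to eq))

  x⊕[x⊕y]≡y : ∀ x y → x ⊕ (x ⊕ y) ≡ y
  x⊕[x⊕y]≡y x y = trans (sym (⊕-assoc x x y)) (trans (cong (_⊕ y) (x⊕x≡𝟎 x)) (⊕-identityˡ y))

  ⊕-≡𝟎⇒≡ : ∀ {x y} → x ⊕ y ≡ 𝟎 → x ≡ y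
  ⊕-≡𝟎⇒≡ {x} {y} eq = trans (sym (⊕-identityʳ x)) (trans (cong (x ⊕_) (sym eq)) (x⊕[x⊕y]≡y x y))

  ⊗-≡𝟎 : ∀ {x y} → x ≢ 𝟎 → x ⊗ y ≡ 𝟎 → y ≡ 𝟎
  ⊗-≡𝟎 {x} {y} x≢𝟎 xy≡𝟎 with inverse x x≢𝟎
  ... | z , xz≡𝟏 = begin
    y             ≡⟨ ⊗-identityˡ y ⟨
    𝟏 ⊗ y         ≡⟨ cong (_⊗ y) xz≡𝟏 ⟨
    x ⊗ z ⊗ y     ≡⟨ solve 3 (λ x z y → x :* z :* y := z :* (x :* y)) refl x z y ⟩
    z ⊗ (x ⊗ y)   ≡⟨ cong (z ⊗_) xy≡𝟎 ⟩
    z ⊗ 𝟎         ≡⟨ zeroʳ z ⟩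
    𝟎             ∎
    where
    open ≡-Reasoning
    open SemiringSolver commutativeSemiring

𝔽₂ : CharTwoField
𝔽₂ = record
  { Carrier = Bool ; _⊕_ = _⊻_ ; _⊗_ = _∧_ ; 𝟎 = false ; 𝟏 = true
  ; isCommutativeSemiring = CommutativeRing.isCommutativeSemiring xor-∧-commutativeRing
  ; x⊕x≡𝟎 = λ { true → refl ; false → refl }
  ; inverse = λ { true _ → true , refl ; false ne → contradiction refl ne }
  ; θ = true
  ; θ-irr = λ { true () ; false () }
  ; size = 2
  ; to = λ { true → suc zero ; false → zero }
  ; from = λ { zero → false ; (suc _) → true }
  ; to-from = λ { zero → refl ; (suc zero) → refl }
  ; from-to = λ { true → refl ; false → refl }
  }

-- The pair (a , b) stands for a + b z with z² = z + θ; the new θ is θ z.  If y = a + b z were a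
-- root of y² + y = θ z, comparing the coefficients of z would give b² + b = θ.
module QuadraticExtension (𝔽 : CharTwoField) where
  open CharTwoField 𝔽
  open SemiringSolver commutativeSemiring using (solve; _:+_; _:*_; _:=_)

  infixl 6 _⊞_
  infixl 7 _⊠_

  _⊞_ _⊠_ : Carrier × Carrier → Carrier × Carrier → Carrier × Carrier
  (a , b) ⊞ (c , d) = a ⊕ c , b ⊕ d
  (a , b) ⊠ (c , d) = a ⊗ c ⊕ θ ⊗ (b ⊗ d) , a ⊗ d ⊕ b ⊗ c ⊕ b ⊗ d

  ⊞-⊠-isCommutativeSemiring : IsCommutativeSemiring _≡_ _⊞_ _⊠_ (𝟎 , 𝟎) (𝟏 , 𝟎)
  ⊞-⊠-isCommutativeSemiring = record
    { isSemiring = record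
      { isSemiringWithoutAnnihilatingZero = record
        { +-isCommutativeMonoid = record
          { isMonoid = record
            { isSemigroup = record
              { isMagma = record { isEquivalence = ≡-isEquivalence ; ∙-cong = cong₂ _⊞_ }
              ; assoc = λ (a , b) (c , d) (e , f) → cong₂ _,_ (⊕-assoc a c e) (⊕-assoc b d f)
              }
            ; identity = (λ (a , b) → cong₂ _,_ (⊕-identityˡ a) (⊕-identityˡ b))
                       , (λ (a , b) → cong₂ _,_ (⊕-identityʳ a) (⊕-identityʳ b))
            }
          ; comm = λ (a , b) (c , d) → cong₂ _,_ (⊕-comm a c) (⊕-comm b d)
          }
        ; *-cong = cong₂ _⊠_
        ; *-assoc = ⊠-assoc
        ; *-identity = ⊠-identityˡ , λ x → trans (⊠-comm x _) (⊠-identityˡ x)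
        ; distrib = ⊠-distribˡ , λ x y z → trans (⊠-comm (y ⊞ z) x) (trans (⊠-distribˡ x y z) (cong₂ _⊞_ (⊠-comm x y) (⊠-comm x z)))
        }
      ; zero = ⊠-zeroˡ , λ x → trans (⊠-comm x _) (⊠-zeroˡ x)
      }
    ; *-comm = ⊠-comm
    }
    where
    ⊠-comm : ∀ x y → x ⊠ y ≡ y ⊠ x
    ⊠-comm (a , b) (c , d) = cong₂ _,_
      (solve 5 (λ a b c d t → a :* c :+ t :* (b :* d) := c :* a :+ t :* (d :* b)) refl a b c d θ)
      (solve 4 (λ a b c d → a :* d :+ b :* c :+ b :* d := c :* b :+ d :* a :+ d :* b) refl a b c d)
    ⊠-assoc : ∀ x y z → (x ⊠ y) ⊠ z ≡ x ⊠ (y ⊠ z)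
    ⊠-assoc (a , b) (c , d) (e , f) = cong₂ _,_
      (solve 7 (λ a b c d e f t →
        (a :* c :+ t :* (b :* d)) :* e :+ t :* ((a :* d :+ b :* c :+ b :* d) :* f) :=
        a :* (c :* e :+ t :* (d :* f)) :+ t :* (b :* (c :* f :+ d :* e :+ d :* f))) refl a b c d e f θ)
      (solve 7 (λ a b c d e f t →
        (a :* c :+ t :* (b :* d)) :* f :+ (a :* d :+ b :* c :+ b :* d) :* e :+ (a :* d :+ b :* c :+ b :* d) :* f :=
        a :* (c :* f :+ d :* e :+ d :* f) :+ b :* (c :* e :+ t :* (d :* f)) :+ b :* (c :* f :+ d :* e :+ d :* f)) refl a b c d e f θ)
    ⊠-distribˡ : ∀ x y z → x ⊠ (y ⊞ z) ≡ x ⊠ y ⊞ x ⊠ z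
    ⊠-distribˡ (a , b) (c , d) (e , f) = cong₂ _,_
      (solve 7 (λ a b c d e f t → a :* (c :+ e) :+ t :* (b :* (d :+ f)) :=
        a :* c :+ t :* (b :* d) :+ (a :* e :+ t :* (b :* f))) refl a b c d e f θ)
      (solve 6 (λ a b c d e f → a :* (d :+ f) :+ b :* (c :+ e) :+ b :* (d :+ f) :=
        a :* d :+ b :* c :+ b :* d :+ (a :* f :+ b :* e :+ b :* f)) refl a b c d e f)
    ⊠-zeroˡ : ∀ x → (𝟎 , 𝟎) ⊠ x ≡ (𝟎 , 𝟎)
    ⊠-zeroˡ (a , b) = cong₂ _,_
      (trans (cong₂ _⊕_ (zeroˡ a) (trans (cong (θ ⊗_) (zeroˡ b)) (zeroʳ θ))) (⊕-identityˡ 𝟎))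
      (trans (cong₂ _⊕_ (trans (cong₂ _⊕_ (zeroˡ b) (zeroˡ a)) (⊕-identityˡ 𝟎)) (zeroˡ b)) (⊕-identityˡ 𝟎))
    ⊠-identityˡ : ∀ x → (𝟏 , 𝟎) ⊠ x ≡ x
    ⊠-identityˡ (a , b) = cong₂ _,_
      (trans (cong₂ _⊕_ (⊗-identityˡ a) (trans (cong (θ ⊗_) (zeroˡ b)) (zeroʳ θ))) (⊕-identityʳ a))
      (trans (cong₂ _⊕_ (trans (cong₂ _⊕_ (⊗-identityˡ b) (zeroˡ a)) (⊕-identityʳ b)) (zeroˡ b)) (⊕-identityʳ b))

  -- The conjugate of z is z + 1, and this is the product of a + b z with its conjugate (a + b) + b
  -- z.
  norm : Carrier → Carrier → Carrier
  norm a b = a ⊗ (a ⊕ b) ⊕ θ ⊗ (b ⊗ b)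

  -- For b = 0 the norm is a². Otherwise a zero norm divided by b² makes a / b a root of y² + y = θ.
  norm≢𝟎 : ∀ a b → (a , b) ≢ (𝟎 , 𝟎) → norm a b ≢ 𝟎
  norm≢𝟎 a b ≢𝟎 norm≡𝟎 with b ≟ᴷ 𝟎
  ... | yes refl with a ≟ᴷ 𝟎
  ...   | yes refl = ≢𝟎 refl
  ...   | no a≢𝟎   = a≢𝟎 (⊗-≡𝟎 a≢𝟎 (begin
    a ⊗ a                        ≡⟨ cong (a ⊗_) (⊕-identityʳ a) ⟨
    a ⊗ (a ⊕ 𝟎)                  ≡⟨ ⊕-≡𝟎⇒≡ norm≡𝟎 ⟩
    θ ⊗ (𝟎 ⊗ 𝟎)                  ≡⟨ cong (θ ⊗_) (zeroˡ 𝟎) ⟩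
    θ ⊗ 𝟎                        ≡⟨ zeroʳ θ ⟩
    𝟎                            ∎))
    where open ≡-Reasoning
  norm≢𝟎 a b ≢𝟎 norm≡𝟎 | no b≢𝟎 with inverse b b≢𝟎
  ... | b⁻¹ , bb⁻¹≡𝟏 = θ-irr (a ⊗ b⁻¹) (begin
    a ⊗ b⁻¹ ⊗ (a ⊗ b⁻¹) ⊕ a ⊗ b⁻¹
      ≡⟨ cong (a ⊗ b⁻¹ ⊗ (a ⊗ b⁻¹) ⊕_) (trans (cong (a ⊗ b⁻¹ ⊗_) bb⁻¹≡𝟏) (⊗-identityʳ _)) ⟨
    a ⊗ b⁻¹ ⊗ (a ⊗ b⁻¹) ⊕ a ⊗ b⁻¹ ⊗ (b ⊗ b⁻¹)
      ≡⟨ solve 3 (λ a b c → a :* c :* (a :* c) :+ a :* c :* (b :* c) := (a :* (a :+ b)) :* (c :* c)) refl a b b⁻¹ ⟩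
    (a ⊗ (a ⊕ b)) ⊗ (b⁻¹ ⊗ b⁻¹)
      ≡⟨ cong (_⊗ (b⁻¹ ⊗ b⁻¹)) (⊕-≡𝟎⇒≡ norm≡𝟎) ⟩
    θ ⊗ (b ⊗ b) ⊗ (b⁻¹ ⊗ b⁻¹)
      ≡⟨ solve 3 (λ t b c → t :* (b :* b) :* (c :* c) := t :* ((b :* c) :* (b :* c))) refl θ b b⁻¹ ⟩
    θ ⊗ ((b ⊗ b⁻¹) ⊗ (b ⊗ b⁻¹))
      ≡⟨ cong (θ ⊗_) (trans (cong₂ _⊗_ bb⁻¹≡𝟏 bb⁻¹≡𝟏) (⊗-identityˡ 𝟏)) ⟩
    θ ⊗ 𝟏
      ≡⟨ ⊗-identityʳ θ ⟩
    θ ∎)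
    where open ≡-Reasoning

  -- The inverse is the conjugate divided by the norm.
  ⊠-inverse : ∀ x → x ≢ (𝟎 , 𝟎) → ∃[ y ] x ⊠ y ≡ (𝟏 , 𝟎)
  ⊠-inverse (a , b) ≢𝟎 with inverse (norm a b) (norm≢𝟎 a b ≢𝟎)
  ... | ν⁻¹ , νν⁻¹≡𝟏 = ((a ⊕ b) ⊗ ν⁻¹ , b ⊗ ν⁻¹) , cong₂ _,_
    (trans (solve 4 (λ a b c t → a :* ((a :+ b) :* c) :+ t :* (b :* (b :* c)) := (a :* (a :+ b) :+ t :* (b :* b)) :* c)
              refl a b ν⁻¹ θ) νν⁻¹≡𝟏)
    (trans (solve 3 (λ a b c → a :* (b :* c) :+ b :* ((a :+ b) :* c) :+ b :* (b :* c) :=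
                               (a :* b :* c :+ b :* b :* c) :+ (a :* b :* c :+ b :* b :* c)) refl a b ν⁻¹)
           (x⊕x≡𝟎 _))

  extension : CharTwoField
  extension = record
    { Carrier = Carrier × Carrier ; _⊕_ = _⊞_ ; _⊗_ = _⊠_ ; 𝟎 = 𝟎 , 𝟎 ; 𝟏 = 𝟏 , 𝟎
    ; isCommutativeSemiring = ⊞-⊠-isCommutativeSemiring
    ; x⊕x≡𝟎 = λ (a , b) → cong₂ _,_ (x⊕x≡𝟎 a) (x⊕x≡𝟎 b)
    ; inverse = ⊠-inverse
    ; θ = 𝟎 , θ
    ; θ-irr = λ (a , b) eq → θ-irr b (trans (sym (coefficient a b)) (cong proj₂ eq))
    ; size = size * size
    ; to = λ (a , b) → combine (to a) (to b)
    ; from = λ i → from (proj₁ (remQuot {size} size i)) , from (proj₂ (remQuot {size} size i))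
    ; to-from = λ i → trans (cong₂ combine (to-from _) (to-from _)) (combine-remQuot {size} size i)
    ; from-to = λ (a , b) → cong₂ _,_
        (trans (cong (λ p → from (proj₁ p)) (remQuot-combine (to a) (to b))) (from-to a))
        (trans (cong (λ p → from (proj₂ p)) (remQuot-combine (to a) (to b))) (from-to b))
    }
    where
    coefficient : ∀ a b → a ⊗ b ⊕ b ⊗ a ⊕ b ⊗ b ⊕ b ≡ b ⊗ b ⊕ b
    coefficient a b = cong (_⊕ b) (trans
      (cong (_⊕ b ⊗ b) (trans (cong (a ⊗ b ⊕_) (⊗-comm b a)) (x⊕x≡𝟎 (a ⊗ b))))
      (⊕-identityˡ (b ⊗ b)))

-- Stage j has 2^(2^j) elements. Each stage squares the size, so the number of ranks, of labels and
-- of vertices can all be taken as sizes of stages, and they are exact powers of each other.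
tower : ℕ → CharTwoField
tower zero    = 𝔽₂
tower (suc j) = QuadraticExtension.extension (tower j)

-- Balanced labels and the second moment of their counts.

-- The square of a difference with the cross term moved to the other side, which is how a variance
-- is computed below without subtraction.
∣-∣²+2mn≡m²+n² : ∀ m n → ∣ m - n ∣ * ∣ m - n ∣ + 2 * (m * n) ≡ m * m + n * n
∣-∣²+2mn≡m²+n² m n with ≤-total m n
... | inj₁ m≤n with m≤n⇒∃[o]m+o≡n m≤n
...   | k , refl rewrite ∣m-m+n∣≡n m k = lemma m k
  where
  lemma : ∀ m k → k * k + 2 * (m * (m + k)) ≡ m * m + (m + k) * (m + k)
  lemma = solve-∀
∣-∣²+2mn≡m²+n² m n | inj₂ n≤m with m≤n⇒∃[o]m+o≡n n≤m
...   | k , refl rewrite ∣-∣-comm (n + k) n | ∣m-m+n∣≡n n k = lemma n k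
  where
  lemma : ∀ n k → k * k + 2 * ((n + k) * n) ≡ (n + k) * (n + k) + n * n
  lemma = solve-∀

module FieldSums (𝔽 : CharTwoField) where
  open CharTwoField 𝔽 public

  sumK : (Carrier → ℕ) → ℕ
  sumK f = sum (λ i → f (from i))

  sumK-cong : ∀ {f g} → (∀ x → f x ≡ g x) → sumK f ≡ sumK g
  sumK-cong f≡g = sum-cong-≗ (λ i → f≡g (from i))

  sumK-const : ∀ c → sumK (λ _ → c) ≡ size * c
  sumK-const = sum-const size

  sumK-bijection : ∀ (g h : Carrier → Carrier) → (∀ x → g (h x) ≡ x) → (∀ x → h (g x) ≡ x) →
                   ∀ f → sumK (λ x → f (g x)) ≡ sumK f
  sumK-bijection g h gh hg f = begin
    sum (λ i → f (g (from i)))               ≡⟨ sum-cong-≗ (λ i → cong f (from-to (g (from i)))) ⟨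
    sum (λ i → f (from (to (g (from i)))))   ≡⟨ sum-permute (λ i → f (from i)) π ⟨
    sum (λ i → f (from i))                   ∎
    where
    open ≡-Reasoning
    conj : ∀ (g h : Carrier → Carrier) → (∀ x → g (h x) ≡ x) → ∀ i → to (g (from (to (h (from i))))) ≡ i
    conj g h gh i = trans (cong (λ x → to (g x)) (from-to _)) (trans (cong to (gh _)) (to-from i))
    π = permutation (λ i → to (g (from i))) (λ i → to (h (from i))) (conj g h gh) (conj h g hg)

  sumK-shift : ∀ s f → sumK (λ x → f (s ⊕ x)) ≡ sumK f
  sumK-shift s = sumK-bijection (s ⊕_) (s ⊕_) (x⊕[x⊕y]≡y s) (x⊕[x⊕y]≡y s)

  sumK-scale : ∀ {δ} → δ ≢ 𝟎 → ∀ f → sumK (λ x → f (δ ⊗ x)) ≡ sumK f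
  sumK-scale {δ} δ≢𝟎 with inverse δ δ≢𝟎
  ... | ε , δε≡𝟏 = sumK-bijection (δ ⊗_) (ε ⊗_) (cancel δ ε δε≡𝟏) (cancel ε δ (trans (⊗-comm ε δ) δε≡𝟏))
    where
    cancel : ∀ x y → x ⊗ y ≡ 𝟏 → ∀ z → x ⊗ (y ⊗ z) ≡ z
    cancel x y xy≡𝟏 z = trans (sym (⊗-assoc x y z)) (trans (cong (_⊗ z) xy≡𝟏) (⊗-identityˡ z))

  Balanced : ∀ {M} → (Carrier → Fin M) → Set
  Balanced {M} ℓ = ∀ c → M * sumK (λ x → ⟦ ⌊ ℓ x ≟ c ⌋ ⟧) ≡ size

-- The label set is itself a stage of the tower, reached by keeping the first coordinate `d` times.
-- All fibres of this projection have the same size, so the labels are uniform without rounding.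
leading : ∀ d j → CharTwoField.Carrier (tower (d + j)) → Fin (CharTwoField.size (tower j))
leading zero    j x       = CharTwoField.to (tower j) x
leading (suc d) j (x , _) = leading d j x

leading-balanced : ∀ d j → FieldSums.Balanced (tower (d + j)) (leading d j)
leading-balanced zero j c = begin
  size * sumK (λ x → ⟦ ⌊ to x ≟ c ⌋ ⟧)
    ≡⟨ cong (size *_) (sum-cong-≗ (λ i → cong (λ k → ⟦ ⌊ k ≟ c ⌋ ⟧) (to-from i))) ⟩
  size * sum (λ i → ⟦ ⌊ i ≟ c ⌋ ⟧)          ≡⟨ cong (size *_) (sum-δ c) ⟩
  size * 1                                  ≡⟨ *-identityʳ size ⟩
  size                                      ∎
  where
  open ≡-Reasoning
  open FieldSums (tower j)
leading-balanced (suc d) j c = begin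
  M * sum (λ i → g (from (proj₁ (remQuot {size} size i))))
    ≡⟨ cong (M *_) (sum-remQuot size size (λ p → g (from (proj₁ p)))) ⟩
  M * sum (λ i → sum {size} (λ k → g (from i)))
    ≡⟨ cong (M *_) (sum-cong-≗ (λ i → sum-const size (g (from i)))) ⟩
  M * sum (λ i → size * g (from i))
    ≡⟨ cong (M *_) (*-distribˡ-sum size (λ i → g (from i))) ⟨
  M * (size * sumK g)                                               ≡⟨ swap M size (sumK g) ⟩
  size * (M * sumK g)                                               ≡⟨ cong (size *_) (leading-balanced d j c) ⟩
  size * size                                                       ∎
  where
  open ≡-Reasoning
  open FieldSums (tower (d + j))
  M = CharTwoField.size (tower j)
  g : Carrier → ℕ
  g x = ⟦ ⌊ leading d j x ≟ c ⌋ ⟧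
  swap : ∀ a b c → a * (b * c) ≡ b * (a * c)
  swap = solve-∀

-- A vertex is a pair (a , b) of field elements, and the edge between (a , b) and (a′ , b′) carries
-- the label of a a′ + b + b′.  For vertices with different first coordinates these labels are
-- independent and uniform over a random third vertex, so a second moment bound applies.
module Labelling (𝔽 : CharTwoField) (M : ℕ) (ℓ : CharTwoField.Carrier 𝔽 → Fin M)
                 (ℓ-balanced : FieldSums.Balanced 𝔽 ℓ) where
  open FieldSums 𝔽
  open SemiringSolver commutativeSemiring using (solve; _:+_; _:*_; _:=_)

  N : ℕ
  N = size * size

  row : Fin N → Fin size
  row v = proj₁ (remQuot {size} size v)

  fst snd : Fin N → Carrier
  fst v = from (row v)
  snd v = from (proj₂ (remQuot {size} size v))

  inner : Fin N → Fin N → Carrier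
  inner v w = fst v ⊗ fst w ⊕ (snd v ⊕ snd w)

  lab : Fin N → Fin N → Fin M
  lab v w = ℓ (inner v w)

  lab-sym : ∀ v w → lab v w ≡ lab w v
  lab-sym v w = cong ℓ (cong₂ _⊕_ (⊗-comm _ _) (⊕-comm _ _))

  link : Fin M → Fin N → Subset N
  link c v w = ⌊ lab v w ≟ c ⌋

  sum-vertices : ∀ (g : Carrier → Carrier → ℕ) →
                 sum {N} (λ v → g (fst v) (snd v)) ≡ sumK (λ a → sumK (λ b → g a b))
  sum-vertices g = sum-remQuot size size (λ p → g (from (proj₁ p)) (from (proj₂ p)))

  sum-inner : ∀ v h → sum (λ w → h (inner w v)) ≡ size * sumK h
  sum-inner v h = begin
    sum (λ w → h (inner w v))
      ≡⟨ sum-vertices (λ a b → h (a ⊗ fst v ⊕ (b ⊕ snd v))) ⟩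
    sumK (λ a → sumK (λ b → h (a ⊗ fst v ⊕ (b ⊕ snd v))))            ≡⟨ sumK-cong (λ a → trans
      (sumK-cong (λ b → cong h (solve 3 (λ s b t → s :+ (b :+ t) := s :+ t :+ b) refl (a ⊗ fst v) b (snd v))))
      (sumK-shift (a ⊗ fst v ⊕ snd v) h)) ⟩
    sumK (λ _ → sumK h)                                              ≡⟨ sumK-const (sumK h) ⟩
    size * sumK h                                                    ∎
    where open ≡-Reasoning

  -- Pairwise independence. Replacing b by the value z of the first inner product turns the second
  -- one into a translate of `δ ⊗ a`. As `δ` is nonzero, this runs through the field when `a` does.
  -- Within one row the two values would differ by a constant.
  sum-inner² : ∀ {u v} → row u ≢ row v → ∀ f g →
               sum (λ w → f (inner w u) * g (inner w v)) ≡ sumK f * sumK g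
  sum-inner² {u} {v} u≢v f g = begin
    sum (λ w → f (inner w u) * g (inner w v))
      ≡⟨ sum-vertices (λ a b → f (a ⊗ x ⊕ (b ⊕ y)) * g (a ⊗ x′ ⊕ (b ⊕ y′))) ⟩
    sumK (λ a → sumK (λ b → f (a ⊗ x ⊕ (b ⊕ y)) * g (a ⊗ x′ ⊕ (b ⊕ y′))))
      ≡⟨ sumK-cong (λ a → sumK-shift (a ⊗ x ⊕ y) (λ b → f (a ⊗ x ⊕ (b ⊕ y)) * g (a ⊗ x′ ⊕ (b ⊕ y′)))) ⟨
    sumK (λ a → sumK (λ z → f (a ⊗ x ⊕ ((a ⊗ x ⊕ y ⊕ z) ⊕ y)) * g (a ⊗ x′ ⊕ ((a ⊗ x ⊕ y ⊕ z) ⊕ y′))))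
      ≡⟨ sumK-cong (λ a → sumK-cong (λ z → cong₂ _*_ (cong f (substitute₁ a z)) (cong g (substitute₂ a z)))) ⟩
    sumK (λ a → sumK (λ z → f z * g ((y ⊕ y′ ⊕ z) ⊕ δ ⊗ a)))
      ≡⟨ ∑-comm (λ i k → f (from k) * g ((y ⊕ y′ ⊕ from k) ⊕ δ ⊗ from i)) ⟩
    sumK (λ z → sumK (λ a → f z * g ((y ⊕ y′ ⊕ z) ⊕ δ ⊗ a)))
      ≡⟨ sumK-cong (λ z → sym (*-distribˡ-sum (f z) (λ i → g ((y ⊕ y′ ⊕ z) ⊕ δ ⊗ from i)))) ⟩
    sumK (λ z → f z * sumK (λ a → g ((y ⊕ y′ ⊕ z) ⊕ δ ⊗ a)))
      ≡⟨ sumK-cong (λ z → cong (f z *_) (trans (sumK-scale δ≢𝟎 (λ c → g ((y ⊕ y′ ⊕ z) ⊕ c))) (sumK-shift (y ⊕ y′ ⊕ z) g))) ⟩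
    sumK (λ z → f z * sumK g)
      ≡⟨ *-distribʳ-sum (sumK g) (λ i → f (from i)) ⟨
    sumK f * sumK g ∎
    where
    open ≡-Reasoning
    x = fst u
    y = snd u
    x′ = fst v
    y′ = snd v
    δ = x ⊕ x′
    δ≢𝟎 : δ ≢ 𝟎
    δ≢𝟎 eq = u≢v (trans (sym (to-from _)) (trans (cong to (⊕-≡𝟎⇒≡ eq)) (to-from _)))
    substitute₁ : ∀ a z → a ⊗ x ⊕ ((a ⊗ x ⊕ y ⊕ z) ⊕ y) ≡ z
    substitute₁ a z = trans
      (solve 3 (λ s y z → s :+ ((s :+ y :+ z) :+ y) := (s :+ y) :+ ((s :+ y) :+ z)) refl (a ⊗ x) y z)
      (x⊕[x⊕y]≡y (a ⊗ x ⊕ y) z)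
    substitute₂ : ∀ a z → a ⊗ x′ ⊕ ((a ⊗ x ⊕ y ⊕ z) ⊕ y′) ≡ (y ⊕ y′ ⊕ z) ⊕ δ ⊗ a
    substitute₂ a z = solve 6 (λ a x x′ y y′ z →
      a :* x′ :+ ((a :* x :+ y :+ z) :+ y′) := (y :+ y′ :+ z) :+ (x :+ x′) :* a) refl a x x′ y y′ z

  module _ (c : Fin M) (R : Subset N) where
    private
      h : Carrier → ℕ
      h z = ⟦ ⌊ ℓ z ≟ c ⌋ ⟧
      H = sumK h
      r = # R
      X : Fin N → ℕ
      X w = # (link c w ∩ R)

      X-sum : ∀ w → X w ≡ sum (λ u → h (inner w u) * ⟦ R u ⟧)
      X-sum w = trans (#-sum (link c w ∩ R)) (sum-cong-≗ (λ u → ⟦∧⟧ (link c w u) (R u)))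

      ΣX : sum X ≡ size * H * r
      ΣX = begin
        sum X                                                  ≡⟨ sum-cong-≗ X-sum ⟩
        sum (λ w → sum (λ u → h (inner w u) * ⟦ R u ⟧))        ≡⟨ ∑-comm (λ w u → h (inner w u) * ⟦ R u ⟧) ⟩
        sum (λ u → sum (λ w → h (inner w u) * ⟦ R u ⟧))        ≡⟨ sum-cong-≗ (λ u → trans
          (sym (*-distribʳ-sum ⟦ R u ⟧ (λ w → h (inner w u)))) (cong (_* ⟦ R u ⟧) (sum-inner u h))) ⟩
        sum (λ u → size * H * ⟦ R u ⟧)                         ≡⟨ *-distribˡ-sum (size * H) (λ u → ⟦ R u ⟧) ⟨
        size * H * sum (λ u → ⟦ R u ⟧)                         ≡⟨ cong (size * H *_) (#-sum R) ⟨
        size * H * r                                           ∎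
        where open ≡-Reasoning

      same : Fin N → Fin N → ℕ
      same u v = ⟦ ⌊ row v ≟ row u ⌋ ⟧

      Σsame : ∀ u → sum (λ v → same u v) ≡ size
      Σsame u = begin
        sum (λ v → same u v)
          ≡⟨ sum-remQuot size size (λ p → ⟦ ⌊ proj₁ p ≟ row u ⌋ ⟧) ⟩
        sum (λ i → sum {size} (λ k → ⟦ ⌊ i ≟ row u ⌋ ⟧))
          ≡⟨ sum-cong-≗ (λ i → sum-const size ⟦ ⌊ i ≟ row u ⌋ ⟧) ⟩
        sum (λ i → size * ⟦ ⌊ i ≟ row u ⌋ ⟧)
          ≡⟨ *-distribˡ-sum size (λ i → ⟦ ⌊ i ≟ row u ⌋ ⟧) ⟨
        size * sum (λ i → ⟦ ⌊ i ≟ row u ⌋ ⟧)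
          ≡⟨ cong (size *_) (sum-δ (row u)) ⟩
        size * 1
          ≡⟨ *-identityʳ size ⟩
        size ∎
        where open ≡-Reasoning

      -- Only `size` of the N vertices share the row of `u`, so the trivial bound N is affordable
      -- for them.
      codegree : ∀ u v → sum (λ w → h (inner w u) * h (inner w v)) ≤ H * H + same u v * N
      codegree u v with row v ≟ row u
      ... | yes _ = ≤-trans (sum-≤-const 1 (λ w → *-mono-≤ (⟦⟧≤1 ⌊ ℓ (inner w u) ≟ c ⌋) (⟦⟧≤1 ⌊ ℓ (inner w v) ≟ c ⌋)))
                      (≤-trans (≤-reflexive (trans (*-identityʳ N) (sym (+-identityʳ N)))) (m≤n+m (N + 0) (H * H)))
      ... | no neq = ≤-reflexive (trans (sum-inner² (λ eq → neq (sym eq)) h h) (sym (+-identityʳ _)))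

      ΣX² : sum (λ w → X w * X w) ≤ r * r * (H * H) + r * (size * N)
      ΣX² = begin
        sum (λ w → X w * X w)
          ≡⟨ sum-cong-≗ (λ w → trans (cong₂ _*_ (X-sum w) (X-sum w)) (sym (sum-* (λ u → h (inner w u) * ⟦ R u ⟧) (λ v → h (inner w v) * ⟦ R v ⟧)))) ⟩
        sum (λ w → sum (λ u → sum (λ v → t w u v)))
          ≡⟨ ∑-comm (λ w u → sum (λ v → t w u v)) ⟩
        sum (λ u → sum (λ w → sum (λ v → t w u v)))
          ≡⟨ sum-cong-≗ (λ u → ∑-comm (λ w v → t w u v)) ⟩
        sum (λ u → sum (λ v → sum (λ w → t w u v)))
          ≡⟨ sum-cong-≗ (λ u → sum-cong-≗ (λ v → trans
               (sum-cong-≗ (λ w → regroup (h (inner w u)) ⟦ R u ⟧ (h (inner w v)) ⟦ R v ⟧))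
               (sym (*-distribˡ-sum (⟦ R u ⟧ * ⟦ R v ⟧) (λ w → h (inner w u) * h (inner w v)))))) ⟩
        sum (λ u → sum (λ v → ⟦ R u ⟧ * ⟦ R v ⟧ * sum (λ w → h (inner w u) * h (inner w v))))
          ≤⟨ sum-mono (λ u → sum-mono (λ v → bound u v)) ⟩
        sum (λ u → sum (λ v → ⟦ R u ⟧ * (⟦ R v ⟧ * (H * H) + same u v * N)))
          ≡⟨ sum-cong-≗ (λ u → trans (sym (*-distribˡ-sum ⟦ R u ⟧ (λ v → ⟦ R v ⟧ * (H * H) + same u v * N))) (cong (⟦ R u ⟧ *_) (row-sum u))) ⟩
        sum (λ u → ⟦ R u ⟧ * (r * (H * H) + size * N))
          ≡⟨ *-distribʳ-sum (r * (H * H) + size * N) (λ u → ⟦ R u ⟧) ⟨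
        sum (λ u → ⟦ R u ⟧) * (r * (H * H) + size * N)
          ≡⟨ cong (_* (r * (H * H) + size * N)) (#-sum R) ⟨
        r * (r * (H * H) + size * N)
          ≡⟨ expand r (H * H) (size * N) ⟩
        r * r * (H * H) + r * (size * N) ∎
        where
        open ≤-Reasoning
        t : Fin N → Fin N → Fin N → ℕ
        t w u v = (h (inner w u) * ⟦ R u ⟧) * (h (inner w v) * ⟦ R v ⟧)
        regroup : ∀ a b c d → (a * b) * (c * d) ≡ b * d * (a * c)
        regroup = solve-∀
        expand : ∀ r a b → r * (r * a + b) ≡ r * r * a + r * b
        expand = solve-∀
        bound : ∀ u v → ⟦ R u ⟧ * ⟦ R v ⟧ * sum (λ w → h (inner w u) * h (inner w v)) ≤ ⟦ R u ⟧ * (⟦ R v ⟧ * (H * H) + same u v * N)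
        bound u v = begin
          ⟦ R u ⟧ * ⟦ R v ⟧ * sum (λ w → h (inner w u) * h (inner w v))
            ≤⟨ *-monoʳ-≤ (⟦ R u ⟧ * ⟦ R v ⟧) (codegree u v) ⟩
          ⟦ R u ⟧ * ⟦ R v ⟧ * (H * H + same u v * N)                        ≡⟨ *-assoc ⟦ R u ⟧ _ _ ⟩
          ⟦ R u ⟧ * (⟦ R v ⟧ * (H * H + same u v * N))
            ≡⟨ cong (⟦ R u ⟧ *_) (*-distribˡ-+ ⟦ R v ⟧ (H * H) (same u v * N)) ⟩
          ⟦ R u ⟧ * (⟦ R v ⟧ * (H * H) + ⟦ R v ⟧ * (same u v * N))
            ≤⟨ *-monoʳ-≤ ⟦ R u ⟧ (+-monoʳ-≤ (⟦ R v ⟧ * (H * H))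
            (≤-trans (*-monoˡ-≤ (same u v * N) (⟦⟧≤1 (R v))) (≤-reflexive (*-identityˡ (same u v * N))))) ⟩
          ⟦ R u ⟧ * (⟦ R v ⟧ * (H * H) + same u v * N)                      ∎
        row-sum : ∀ u → sum (λ v → ⟦ R v ⟧ * (H * H) + same u v * N) ≡ r * (H * H) + size * N
        row-sum u = trans (∑-distrib-+ (λ v → ⟦ R v ⟧ * (H * H)) (λ v → same u v * N)) (cong₂ _+_
          (trans (sym (*-distribʳ-sum (H * H) (λ v → ⟦ R v ⟧))) (cong (_* (H * H)) (sym (#-sum R))))
          (trans (sym (*-distribʳ-sum N (λ v → same u v))) (cong (_* N) (Σsame u))))

      dev : Fin N → ℕ
      dev w = ∣ M * X w - r ∣

      -- Because M * H is exactly `size`, the mean of M * X w is exactly r. After the cross term 2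
      -- r² N is added on both sides the main terms cancel, and only the contribution of pairs in a
      -- common row survives.
      Σdev² : sum (λ w → dev w * dev w) ≤ M * M * (r * (size * N))
      Σdev² = +-cancelʳ-≤ (2 * (r * r * N)) _ _ (begin
        sum (λ w → dev w * dev w) + 2 * (r * r * N)
          ≡⟨ cong (sum (λ w → dev w * dev w) +_) cross ⟩
        sum (λ w → dev w * dev w) + sum (λ w → 2 * (M * X w * r))
          ≡⟨ ∑-distrib-+ (λ w → dev w * dev w) (λ w → 2 * (M * X w * r)) ⟨
        sum (λ w → dev w * dev w + 2 * (M * X w * r))
          ≡⟨ sum-cong-≗ (λ w → ∣-∣²+2mn≡m²+n² (M * X w) r) ⟩
        sum (λ w → (M * X w) * (M * X w) + r * r)
          ≡⟨ ∑-distrib-+ (λ w → (M * X w) * (M * X w)) (λ w → r * r) ⟩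
        sum (λ w → (M * X w) * (M * X w)) + sum {N} (λ w → r * r)
          ≡⟨ cong₂ _+_ (trans (sum-cong-≗ (λ w → square M (X w))) (sym (*-distribˡ-sum (M * M) (λ w → X w * X w)))) (sum-const N (r * r)) ⟩
        M * M * sum (λ w → X w * X w) + N * (r * r)
          ≤⟨ +-monoˡ-≤ (N * (r * r)) (*-monoʳ-≤ (M * M) ΣX²) ⟩
        M * M * (r * r * (H * H) + r * (size * N)) + N * (r * r)
          ≡⟨ expand M r H (r * (size * N)) (N * (r * r)) ⟩
        M * M * (r * (size * N)) + (r * r * ((M * H) * (M * H)) + N * (r * r))
          ≡⟨ cong (λ q → M * M * (r * (size * N)) + (r * r * (q * q) + N * (r * r))) (ℓ-balanced c) ⟩
        M * M * (r * (size * N)) + (r * r * N + N * (r * r))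
          ≡⟨ cong (M * M * (r * (size * N)) +_) (double (r * r) N) ⟩
        M * M * (r * (size * N)) + 2 * (r * r * N) ∎)
        where
        open ≤-Reasoning
        square : ∀ m x → (m * x) * (m * x) ≡ m * m * (x * x)
        square = solve-∀
        expand : ∀ m r h a b → m * m * (r * r * (h * h) + a) + b ≡ m * m * a + (r * r * ((m * h) * (m * h)) + b)
        expand = solve-∀
        double : ∀ a b → a * b + b * a ≡ 2 * (a * b)
        double = solve-∀
        rearrange : ∀ m s h r → 2 * r * m * (s * h * r) ≡ 2 * (r * r * (s * (m * h)))
        rearrange = solve-∀
        factor : ∀ m x r → 2 * r * m * x ≡ 2 * (m * x * r)
        factor = solve-∀
        cross : 2 * (r * r * N) ≡ sum (λ w → 2 * (M * X w * r))
        cross = begin-equality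
          2 * (r * r * N)                       ≡⟨ cong (λ q → 2 * (r * r * (size * q))) (ℓ-balanced c) ⟨
          2 * (r * r * (size * (M * H)))        ≡⟨ rearrange M size H r ⟨
          2 * r * M * (size * H * r)            ≡⟨ cong (2 * r * M *_) ΣX ⟨
          2 * r * M * sum X                     ≡⟨ *-distribˡ-sum (2 * r * M) X ⟩
          sum (λ w → 2 * r * M * X w)           ≡⟨ sum-cong-≗ (λ w → factor M (X w) r) ⟩
          sum (λ w → 2 * (M * X w * r))         ∎

    -- Chebyshev's inequality. Bounding `# R` by N makes it uniform in R.
    deviant-bound : ∀ τ → # (λ w → ⌊ τ <? ∣ M * # (link c w ∩ R) - # R ∣ ⌋) * (τ * τ) ≤ M * M * (N * (size * N))
    deviant-bound τ = begin
      # (λ w → ⌊ τ <? dev w ⌋) * (τ * τ)                  ≤⟨ *-monoˡ-≤ (τ * τ) (#-mono squares) ⟩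
      # (λ w → ⌊ τ * τ <? dev w * dev w ⌋) * (τ * τ)      ≤⟨ markov (λ w → dev w * dev w) (τ * τ) ⟩
      sum (λ w → dev w * dev w)                           ≤⟨ Σdev² ⟩
      M * M * (r * (size * N))                            ≤⟨ *-monoʳ-≤ (M * M) (*-monoˡ-≤ (size * N) (#≤N R)) ⟩
      M * M * (N * (size * N))                            ∎
      where
      open ≤-Reasoning
      squares : (λ w → ⌊ τ <? dev w ⌋) ⊆ˢ (λ w → ⌊ τ * τ <? dev w * dev w ⌋)
      squares {w} t = let τ<d = ⌊⌋-true (τ <? dev w) t in
        true-⌊⌋ (τ * τ <? dev w * dev w) (*-mono-< τ<d τ<d)

-- Greedy embedding, or a sparse pair of large sets.

Relation : ℕ → Set
Relation N = Fin N → Subset N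

Embeds : ∀ {N n} → (Fin n → Fin n → Relation N) → (Fin n → Subset N) → Set
Embeds {N} {n} R V = Σ (Fin n → Fin N) λ f →
  (∀ b → f b ∈ˢ V b) × (∀ {a b} → a <ᶠ b → f b ∈ˢ R a b (f a))

record SparsePair {N} (E S : ℕ) (R : Relation N) (V W : Subset N) : Set where
  field
    A B    : Subset N
    A⊆V    : A ⊆ˢ V
    B⊆W    : B ⊆ˢ W
    S≤A    : S ≤ # A
    S≤B    : S ≤ # B
    sparse : ∀ {u} → u ∈ˢ A → E * # (R u ∩ B) < # B

-- A vertex of `V zero` is rich if every later set keeps at least a 1 / E fraction in its
-- neighbourhood. A rich vertex is used, and the embedding continues inside these neighbourhoods. If
-- there is none, every vertex of `V zero` is poor towards some later set, and the most frequent
-- such set gives the pair. By `n ≤ E` this choice costs at most one factor E.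
embed-or-sparse : ∀ {N} n {E S} → n ≤ E → 0 < E → 0 < S → (R : Fin n → Fin n → Relation N) (V : Fin n → Subset N) →
                  (∀ b → E ^ n * S ≤ # (V b)) →
                  Embeds R V ⊎ ∃₂ λ a b → SparsePair E S (R a b) (V a) (V b)
embed-or-sparse zero _ _ _ R V _ = inj₁ ((λ ()) , (λ ()) , λ { {()} })
embed-or-sparse {N} (suc n) {E} {S} n<E 0<E 0<S R V large
  with any? (λ v → (V zero v ≟ᵇ true) ×-dec all? (λ b → # (V (suc b)) ≤? E * # (R zero (suc b) v ∩ V (suc b))))
... | yes (v , v∈V , rich) = extend (embed-or-sparse n (<⇒≤ n<E) 0<E 0<S (λ a b → R (suc a) (suc b)) V′ large′)
  where
  V′ : Fin n → Subset N
  V′ b = R zero (suc b) v ∩ V (suc b)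
  instance _ = >-nonZero 0<E
  large′ : ∀ b → E ^ n * S ≤ # (V′ b)
  large′ b = *-cancelˡ-≤ E (begin
    E * (E ^ n * S)   ≡⟨ *-assoc E (E ^ n) S ⟨
    E ^ suc n * S     ≤⟨ large (suc b) ⟩
    # (V (suc b))     ≤⟨ rich b ⟩
    E * # (V′ b)      ∎)
    where open ≤-Reasoning
  extend : Embeds (λ a b → R (suc a) (suc b)) V′ ⊎ ∃₂ (λ a b → SparsePair E S (R (suc a) (suc b)) (V′ a) (V′ b)) →
           Embeds R V ⊎ ∃₂ (λ a b → SparsePair E S (R a b) (V a) (V b))
  extend (inj₂ (a , b , p)) = inj₂ (suc a , suc b , record
    { A = A ; B = B ; S≤A = S≤A ; S≤B = S≤B ; sparse = sparse
    ; A⊆V = λ x → proj₂ (∧-split (A⊆V x)) ; B⊆W = λ x → proj₂ (∧-split (B⊆W x)) })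
    where open SparsePair p
  extend (inj₁ (f , f∈V′ , f-rel)) = inj₁ (g , g∈V , λ {a} {b} → g-rel a b)
    where
    g : Fin (suc n) → Fin N
    g zero    = v
    g (suc b) = f b
    g∈V : ∀ b → g b ∈ˢ V b
    g∈V zero    = v∈V
    g∈V (suc b) = proj₂ (∧-split (f∈V′ b))
    g-rel : ∀ a b → a <ᶠ b → g b ∈ˢ R a b (g a)
    g-rel zero    (suc b) _       = proj₁ (∧-split (f∈V′ b))
    g-rel (suc a) (suc b) (s≤s lt) = f-rel lt
... | no none = inj₂ (zero , suc b , record
  { A = U b ; B = V (suc b) ; A⊆V = λ x → proj₁ (∧-split x) ; B⊆W = id
  ; S≤A = *-cancelˡ-≤ E (begin
      E * S                 ≤⟨ *-monoʳ-≤ E (m≤n*m S (E ^ n)) ⟩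
      E * (E ^ n * S)       ≡⟨ *-assoc E (E ^ n) S ⟨
      E ^ suc n * S         ≤⟨ large zero ⟩
      # (V zero)            ≤⟨ proj₂ pigeon ⟩
      n * # (U b)           ≤⟨ *-monoˡ-≤ (# (U b)) (<⇒≤ n<E) ⟩
      E * # (U b)           ∎)
  ; S≤B = ≤-trans (m≤n*m S (E ^ suc n)) (large (suc b))
  ; sparse = λ x → ⌊⌋-true (E * _ <? # (V (suc b))) (proj₂ (∧-split x)) })
  where
  open ≤-Reasoning
  instance
    _ = >-nonZero 0<E
    _ = m^n≢0 E n
    _ = m^n≢0 E (suc n)
  U : Fin n → Subset N
  U b = V zero ∩ (λ v → ⌊ E * # (R zero (suc b) v ∩ V (suc b)) <? # (V (suc b)) ⌋)
  covered : ∀ {v} → v ∈ˢ V zero → ∃[ b ] v ∈ˢ U b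
  covered {v} v∈V with ¬∀⟶∃¬ n _ (λ b → # (V (suc b)) ≤? E * # (R zero (suc b) v ∩ V (suc b))) (λ rich → none (v , v∈V , rich))
  ... | b , poor = b , ∧-join v∈V (true-⌊⌋ (_ <? _) (≰⇒> poor))
  pigeon = #-pigeonhole U (≤-trans 0<S (≤-trans (m≤n*m S (E ^ suc n)) (large zero))) covered
  b = proj₁ pigeon

-- Nested label windows and families of sparse sets.

module SparseFamilies {N} (red : Relation N) (red-sym : ∀ {u v} → v ∈ˢ red u → u ∈ˢ red v)
                      (lab : Fin N → Fin N → ℕ) (lab-sym : ∀ u v → lab u v ≡ lab v u) where

  within : ℕ → ℕ → Relation N
  within lo w u v = red u v ∧ ⌊ lo ≤? lab u v ⌋ ∧ ⌊ lab u v <? lo + w ⌋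

  within-intro : ∀ {lo w u v} → v ∈ˢ red u → lo ≤ lab u v → lab u v < lo + w → v ∈ˢ within lo w u
  within-intro r l h = ∧-join r (∧-join (true-⌊⌋ (_ ≤? _) l) (true-⌊⌋ (_ <? _) h))

  within-elim : ∀ {lo w u v} → v ∈ˢ within lo w u → v ∈ˢ red u × lo ≤ lab u v × lab u v < lo + w
  within-elim x with ∧-split x
  ... | r , y with ∧-split y
  ...   | l , h = r , ⌊⌋-true (_ ≤? _) l , ⌊⌋-true (_ <? _) h

  within-sym : ∀ {lo w u v} → v ∈ˢ within lo w u → u ∈ˢ within lo w v
  within-sym {lo} {w} {u} {v} x with within-elim x
  ... | r , l , h = within-intro (red-sym r) (subst (lo ≤_) (lab-sym u v) l) (subst (_< lo + w) (lab-sym u v) h)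

  within-mono : ∀ {lo w lo′ w′ u} → lo ≤ lo′ → lo′ + w′ ≤ lo + w → within lo′ w′ u ⊆ˢ within lo w u
  within-mono lo≤ ≤hi x with within-elim x
  ... | r , l , h = within-intro r (≤-trans lo≤ l) (<-≤-trans h ≤hi)

  -- Double counting reverses the direction of sparseness. Each `W i` lies in A, so at most # (W i)
  -- * # B / E related pairs join it to B. Hence at most an F / E fraction of B is related to more
  -- than a 1 / F fraction of `W i`, and by 2 * L * F ≤ E the L exceptional sets together fill at
  -- most half of B.
  prune : ∀ {E F S L} (R : Relation N) → (∀ {u v} → v ∈ˢ R u → u ∈ˢ R v) → 0 < L → 0 < F → 2 * L * F ≤ E → 0 < S →
          ∀ {A B} (W : Fin L → Subset N) → (∀ i → W i ⊆ˢ A) → (∀ i → S ≤ # (W i)) →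
          (∀ {u} → u ∈ˢ A → E * # (R u ∩ B) < # B) →
          # B ≤ 2 * # (B ∩ λ v → not ⌊ any? (λ i → # (W i) <? F * # (R v ∩ W i)) ⌋)
  prune {E} {F} {S} {L} R R-sym 0<L 0<F E-large 0<S {A} {B} W W⊆A W-large sparse =
    +-cancelʳ-≤ (# B) _ _ (begin
      # B + # B                  ≡⟨ double (# B) ⟩
      2 * # B                    ≤⟨ *-monoʳ-≤ 2 (#-union split) ⟩
      2 * (# B* + # bad)         ≡⟨ *-distribˡ-+ 2 (# B*) (# bad) ⟩
      2 * # B* + 2 * # bad       ≤⟨ +-monoʳ-≤ (2 * # B*) few ⟩
      2 * # B* + # B             ∎)
    where
    open ≤-Reasoning
    double : ∀ x → x + x ≡ 2 * x
    double = solve-∀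
    worse : Fin L → Subset N
    worse i = B ∩ λ v → ⌊ # (W i) <? F * # (R v ∩ W i) ⌋
    bad B* : Subset N
    bad = B ∩ λ v → ⌊ any? (λ i → # (W i) <? F * # (R v ∩ W i)) ⌋
    B* = B ∩ λ v → not ⌊ any? (λ i → # (W i) <? F * # (R v ∩ W i)) ⌋
    split : ∀ {v} → v ∈ˢ B → v ∈ˢ B* ⊎ v ∈ˢ bad
    split {v} v∈B with any? (λ i → # (W i) <? F * # (R v ∩ W i))
    ... | yes _ = inj₂ (∧-join v∈B refl)
    ... | no _  = inj₁ (∧-join v∈B refl)
    bad⊆ : ∀ {v} → v ∈ˢ bad → ∃[ i ] v ∈ˢ worse i
    bad⊆ {v} x with ∧-split x
    ... | v∈B , y with ⌊⌋-true (any? (λ i → # (W i) <? F * # (R v ∩ W i))) y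
    ...   | i , lt = i , ∧-join v∈B (true-⌊⌋ (_ <? _) lt)
    edges : Fin L → Fin N → Subset N
    edges i v w = B v ∧ (R v ∩ W i) w
    E*edges : ∀ i → E * sum (λ v → # (edges i v)) ≤ # (W i) * # B
    E*edges i = begin
      E * sum (λ v → # (edges i v))              ≡⟨ cong (E *_) (#-swap (edges i)) ⟩
      E * sum (λ w → # (λ v → edges i v w))      ≡⟨ *-distribˡ-sum E (λ w → # (λ v → edges i v w)) ⟩
      sum (λ w → E * # (λ v → edges i v w))      ≤⟨ sum-mono column ⟩
      sum (λ w → ⟦ W i w ⟧ * # B)                ≡⟨ *-distribʳ-sum (# B) (λ w → ⟦ W i w ⟧) ⟨
      sum (λ w → ⟦ W i w ⟧) * # B                ≡⟨ cong (_* # B) (#-sum (W i)) ⟨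
      # (W i) * # B                              ∎
      where
      column : ∀ w → E * # (λ v → edges i v w) ≤ ⟦ W i w ⟧ * # B
      column w with W i w in eq
      ... | true  = ≤-trans (*-monoʳ-≤ E (#-mono (λ {v} x → case ∧-split {B v} x of λ (v∈B , y) →
                      ∧-join (R-sym (proj₁ (∧-split y))) v∈B)))
                      (≤-trans (<⇒≤ (sparse (W⊆A i eq))) (≤-reflexive (sym (+-identityʳ (# B)))))
      ... | false = ≤-reflexive (trans (cong (E *_) (#-none (λ v → none (B v) (R v w)))) (*-zeroʳ E))
        where
        none : ∀ x y → x ∧ y ∧ false ≡ false
        none true  true  = refl
        none true  false = refl
        none false _     = refl
    worse-few : ∀ i → E * # (worse i) ≤ F * # B
    worse-few i = *-cancelʳ-≤ _ _ (# (W i)) {{>-nonZero (≤-trans 0<S (W-large i))}} (begin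
      E * # (worse i) * # (W i)                      ≡⟨ *-assoc E _ _ ⟩
      E * (# (worse i) * # (W i))                    ≤⟨ *-monoʳ-≤ E (*-monoˡ-≤ (# (W i)) (#-mono heavy)) ⟩
      E * (# (λ v → ⌊ # (W i) <? F * # (edges i v) ⌋) * # (W i))
        ≤⟨ *-monoʳ-≤ E (markov (λ v → F * # (edges i v)) (# (W i))) ⟩
      E * sum (λ v → F * # (edges i v))              ≡⟨ cong (E *_) (*-distribˡ-sum F (λ v → # (edges i v))) ⟨
      E * (F * sum (λ v → # (edges i v)))            ≡⟨ swap E F _ ⟩
      F * (E * sum (λ v → # (edges i v)))            ≤⟨ *-monoʳ-≤ F (E*edges i) ⟩
      F * (# (W i) * # B)                            ≡⟨ rotate F _ _ ⟩
      F * # B * # (W i)                              ∎)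
      where
      swap : ∀ a b c → a * (b * c) ≡ b * (a * c)
      swap = solve-∀
      rotate : ∀ a b c → a * (b * c) ≡ a * c * b
      rotate = solve-∀
      heavy : worse i ⊆ˢ (λ v → ⌊ # (W i) <? F * # (edges i v) ⌋)
      heavy {v} x with ∧-split x
      ... | v∈B , y = true-⌊⌋ (_ <? _) (<-≤-trans (⌊⌋-true (_ <? _) y)
        (*-monoʳ-≤ F (#-mono (λ z → ∧-join v∈B z))))
    few : 2 * # bad ≤ # B
    few = *-cancelˡ-≤ (L * F) {{m*n≢0 L F {{>-nonZero 0<L}} {{>-nonZero 0<F}}}} (begin
      L * F * (2 * # bad)                ≡⟨ pull L F (# bad) ⟩
      2 * L * F * # bad                  ≤⟨ *-monoˡ-≤ (# bad) E-large ⟩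
      E * # bad                          ≤⟨ *-monoʳ-≤ E (#-cover worse bad⊆) ⟩
      E * sum (λ i → # (worse i))        ≡⟨ *-distribˡ-sum E (λ i → # (worse i)) ⟩
      sum (λ i → E * # (worse i))        ≤⟨ sum-≤-const (F * # B) worse-few ⟩
      L * (F * # B)                      ≡⟨ *-assoc L F (# B) ⟨
      L * F * # B                        ∎)
      where
      pull : ∀ a b c → a * b * (2 * c) ≡ 2 * a * b * c
      pull = solve-∀

  -- Sparseness is one-sided, from later parts to earlier ones: pruning against the parts already
  -- found provides this, and the final embedding needs no more.
  record SparseFamily (F S L lo w w′ : ℕ) (V : Subset N) : Set where
    field
      base    : ℕ
      lo≤base : lo ≤ base
      base≤hi : base + w′ ≤ lo + w
      part    : ℕ → Subset N
      part⊆   : ∀ {i} → i < L → part i ⊆ˢ V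
      large   : ∀ {i} → i < L → S ≤ # (part i)
      sparse  : ∀ {i j v} → i < j → j < L → v ∈ˢ part j →
                F * # (within base w′ v ∩ part i) ≤ # (part i)

  -- The family in B lives in the final window of the family in A. Shrinking a window only removes
  -- red edges, so what was sparse for the wider window stays sparse.
  concatenate : ∀ {F S L lo w w′ w″ A B V} (fA : SparseFamily F S L lo w w′ A) →
                let open SparseFamily fA in
                SparseFamily F S L base w′ w″ B → A ⊆ˢ V → B ⊆ˢ V →
                (∀ {i v} → i < L → v ∈ˢ B → F * # (within base w′ v ∩ part i) ≤ # (part i)) →
                SparseFamily F S (L + L) lo w w″ V
  concatenate {F} {S} {L} {lo} {w} {w′} {w″} {A} {B} {V} fA fB A⊆V B⊆V across = record
    { base = FB.base
    ; lo≤base = ≤-trans FA.lo≤base FB.lo≤base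
    ; base≤hi = ≤-trans FB.base≤hi FA.base≤hi
    ; part = part
    ; part⊆ = part⊆
    ; large = large
    ; sparse = sparse
    }
    where
    module FA = SparseFamily fA
    module FB = SparseFamily fB
    upper : ∀ {i} → ¬ i < L → i < L + L → i ∸ L < L
    upper {i} ≮L i< = +-cancelˡ-< L _ _ (subst (_< L + L) (sym (m+[n∸m]≡n (≮⇒≥ ≮L))) i<)
    part : ℕ → Subset N
    part i with i <? L
    ... | yes _ = FA.part i
    ... | no _  = FB.part (i ∸ L)
    part⊆ : ∀ {i} → i < L + L → part i ⊆ˢ V
    part⊆ {i} i< x with i <? L
    ... | yes lt = A⊆V (FA.part⊆ lt x)
    ... | no ge  = B⊆V (FB.part⊆ (upper ge i<) x)
    large : ∀ {i} → i < L + L → S ≤ # (part i)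
    large {i} i< with i <? L
    ... | yes lt = FA.large lt
    ... | no ge  = FB.large (upper ge i<)
    narrow : ∀ v P → F * # (within FB.base w″ v ∩ P) ≤ F * # (within FA.base w′ v ∩ P)
    narrow v P = *-monoʳ-≤ F (#-mono (λ x → ∧-join
      (within-mono FB.lo≤base FB.base≤hi (proj₁ (∧-split x))) (proj₂ (∧-split {within FB.base w″ v _} x))))
    sparse : ∀ {i j v} → i < j → j < L + L → v ∈ˢ part j →
             F * # (within FB.base w″ v ∩ part i) ≤ # (part i)
    sparse {i} {j} {v} i<j j< x with i <? L | j <? L
    ... | yes i<L | yes j<L = ≤-trans (narrow v (FA.part i)) (FA.sparse i<j j<L x)
    ... | yes i<L | no j≮L  = ≤-trans (narrow v (FA.part i)) (across i<L (FB.part⊆ (upper j≮L j<) x))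
    ... | no i≮L  | yes j<L = contradiction (<-trans i<j j<L) i≮L
    ... | no i≮L  | no j≮L  = FB.sparse (∸-monoˡ-< i<j (≮⇒≥ i≮L)) (upper j≮L j<) x

  -- The number of times the window is divided by m: once for the sparse pair, then for the families
  -- in A and in B one after the other.
  depth : ℕ → ℕ
  depth zero    = 0
  depth (suc k) = suc (depth k + depth k)

  suc-depth : ∀ k → suc (depth k) ≡ 2 ^ k
  suc-depth zero    = refl
  suc-depth (suc k) = begin
    suc (suc (depth k + depth k))      ≡⟨ double (depth k) ⟩
    2 * suc (depth k)                  ≡⟨ cong (2 *_) (suc-depth k) ⟩
    2 * 2 ^ k                          ∎
    where
    open ≡-Reasoning
    double : ∀ x → suc (suc (x + x)) ≡ 2 * suc x
    double = solve-∀

  subwindow : ∀ lo m w {r} → r < m → lo + r * w + w ≤ lo + m * w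
  subwindow lo m w {r} r<m = begin
    lo + r * w + w        ≡⟨ regroup lo r w ⟩
    lo + suc r * w        ≤⟨ +-monoʳ-≤ lo (*-monoˡ-≤ w r<m) ⟩
    lo + m * w            ∎
    where
    open ≤-Reasoning
    regroup : ∀ lo r w → lo + r * w + w ≡ lo + suc r * w
    regroup = solve-∀

  module _ {n m E F S : ℕ} (p : Fin n → Fin n → Fin m) (n≤E : n ≤ E) (0<F : 0 < F) (0<S : 0 < S)
           (free : ∀ lo w V → ¬ Embeds (λ a b → within (lo + toℕ (p a b) * w) w) V) where

    -- `d` counts the factors m that the window must retain at the end. The family in A has to
    -- reserve `depth k` further ones for the family in B, so the induction needs `d` to vary. Each
    -- level costs a factor 2 * E ^ n in size: E ^ n for the attempted embedding and 2 for the
    -- pruning of B.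
    sparse-family : ∀ k d lo V → 2 ^ k * F ≤ E → (2 * E ^ n) ^ k * S ≤ # V →
                    SparseFamily F S (2 ^ k) lo (m ^ (depth k + d)) (m ^ d) V
    sparse-family zero d lo V _ V-large = record
      { base = lo ; lo≤base = ≤-refl ; base≤hi = ≤-refl ; part = λ _ → V ; part⊆ = λ _ → id
      ; large = λ _ → ≤-trans (≤-reflexive (sym (+-identityʳ S))) V-large
      ; sparse = λ { {i} {suc j} _ (s≤s ()) _ } }
    sparse-family (suc k) d lo V E-large V-large =
      [ (λ emb → contradiction emb (free lo w (λ _ → V))) , from-pair ]′
      -- The pair is requested at twice the size needed, since pruning may discard half of B.
      (embed-or-sparse n {E} {2 * S′} n≤E 0<E (*-mono-≤ (s≤s {n = 1} z≤n) 0<S′)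
        (λ a b → within (lo + toℕ (p a b) * w) w) (λ _ → V)
        (λ _ → ≤-trans (≤-reflexive (regroup (E ^ n) ((2 * E ^ n) ^ k) S)) V-large))
      where
      w = m ^ (depth k + (depth k + d))
      S′ = (2 * E ^ n) ^ k * S
      0<E : 0 < E
      0<E = ≤-trans (*-mono-≤ (m^n>0 2 (suc k)) 0<F) E-large
      0<S′ : 0 < S′
      0<S′ = *-mono-≤ (m^n>0 (2 * E ^ n) {{m*n≢0 2 (E ^ n) {{_}} {{m^n≢0 E n {{>-nonZero 0<E}}}}}} k) 0<S
      regroup : ∀ e z s → e * (2 * (z * s)) ≡ 2 * e * z * s
      regroup = solve-∀
      E-large′ : 2 ^ k * F ≤ E
      E-large′ = ≤-trans (*-monoˡ-≤ F (m≤n*m (2 ^ k) 2)) E-large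
      Pair = ∃₂ λ a b → SparsePair E (2 * S′) (within (lo + toℕ (p a b) * w) w) V V
      from-pair : Pair → SparseFamily F S (2 ^ suc k) lo (m ^ (depth (suc k) + d)) (m ^ d) V
      from-pair (a , b , pair) = subst₂ (λ L w → SparseFamily F S L lo w (m ^ d) V)
        (cong (2 ^ k +_) (sym (+-identityʳ (2 ^ k)))) (cong (λ e → m * m ^ e) (sym (+-assoc (depth k) (depth k) d)))
        (widen (concatenate fA fB A⊆V (λ x → B⊆W (proj₁ (∧-split x))) across))
        where
        open SparsePair pair
        r = toℕ (p a b)
        fA : SparseFamily F S (2 ^ k) (lo + r * w) w (m ^ (depth k + d)) A
        fA = sparse-family k (depth k + d) (lo + r * w) A E-large′ (≤-trans (m≤n*m S′ 2) S≤A)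
        module FA = SparseFamily fA
        R : Relation N
        R = within FA.base (m ^ (depth k + d))
        crowded? : ∀ v → Dec (∃[ i ] # (FA.part (toℕ i)) < F * # (R v ∩ FA.part (toℕ i)))
        crowded? v = any? {2 ^ k} (λ i → # (FA.part (toℕ i)) <? F * # (R v ∩ FA.part (toℕ i)))
        B* : Subset N
        B* = B ∩ λ v → not ⌊ crowded? v ⌋
        B*-large : S′ ≤ # B*
        B*-large = *-cancelˡ-≤ 2 (≤-trans S≤B
          (prune R (within-sym {FA.base} {m ^ (depth k + d)}) (m^n>0 2 k) 0<F E-large 0<S (λ i → FA.part (toℕ i))
            (λ i → FA.part⊆ (toℕ<n i)) (λ i → FA.large (toℕ<n i))
            (λ {u} u∈A → ≤-<-trans (*-monoʳ-≤ E (#-mono (λ x → ∧-join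
                (within-mono FA.lo≤base FA.base≤hi (proj₁ (∧-split x))) (proj₂ (∧-split {R u _} x)))))
              (sparse u∈A))))
        fB : SparseFamily F S (2 ^ k) FA.base (m ^ (depth k + d)) (m ^ d) B*
        fB = sparse-family k d FA.base B* E-large′ B*-large
        across : ∀ {i v} → i < 2 ^ k → v ∈ˢ B* → F * # (R v ∩ FA.part i) ≤ # (FA.part i)
        across {i} {v} i< x = ≮⇒≥ (λ lt → ⌊⌋-false (crowded? v) (not-true (proj₂ (∧-split {B v} x)))
          (fromℕ< i< , subst (λ i → # (FA.part i) < F * # (R v ∩ FA.part i)) (sym (toℕ-fromℕ< i<)) lt))
        widen : ∀ {L w′} → SparseFamily F S L (lo + r * w) w w′ V → SparseFamily F S L lo (m * w) w′ V
        widen f = record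
          { base = base ; lo≤base = ≤-trans (m≤m+n lo (r * w)) lo≤base
          ; base≤hi = ≤-trans base≤hi (subwindow lo m w (toℕ<n (p a b)))
          ; part = part ; part⊆ = part⊆ ; large = large ; sparse = sparseᶠ }
          where open SparseFamily f renaming (sparse to sparseᶠ)

-- Embedding with prescribed labels while avoiding sparse relations.

∨-elim : ∀ x y → x ∨ y ≡ true → x ≡ true ⊎ y ≡ true
∨-elim true  y eq = inj₁ refl
∨-elim false y eq = inj₂ eq

∨-false : ∀ {x y} → x ∨ y ≡ false → x ≡ false × y ≡ false
∨-false {false} {false} _ = refl , refl

≢true : ∀ {x} → x ≢ true → x ≡ false
≢true {true}  ne = contradiction refl ne
≢true {false} _  = refl

classify : ∀ l y e r x → l ∧ y ≡ true →
           (l ∧ y) ∧ (not e ∧ not r ∧ not x) ≡ true ⊎ e ∨ (r ∧ y) ∨ x ≡ true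
classify true true true  _     _     _ = inj₂ refl
classify true true false true  _     _ = inj₂ refl
classify true true false false true  _ = inj₂ refl
classify true true false false false _ = inj₁ refl

-- `τ` is the tolerated deviation, `σ` bounds the number of vertices deviating on any one set, and
-- `θ` bounds the number of vertices v with more than `τ` exceptional partners u.
module SparseEmbedding {N M : ℕ} (lab : Fin N → Fin N → Fin M) (σ τ θ : ℕ) where

  link : Fin M → Relation N
  link c v w = ⌊ lab v w ≟ c ⌋

  deviant : Fin M → Subset N → Subset N
  deviant c R w = ⌊ τ <? ∣ M * # (link c w ∩ R) - # R ∣ ⌋

  ¬deviant : ∀ {c R w} → deviant c R w ≡ false → ∣ M * # (link c w ∩ R) - # R ∣ ≤ τ
  ¬deviant eq = ≮⇒≥ (⌊⌋-false (τ <? _) eq)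

  record Avoids {n} (c : Fin n → Fin n → Fin M) (ρ : Fin n → Fin n → Relation N)
                (Y : Fin n → Subset N) : Set where
    field
      vertex   : Fin n → Fin N
      vertex∈  : ∀ b → vertex b ∈ˢ Y b
      labelled : ∀ {a b} → a <ᶠ b → lab (vertex a) (vertex b) ≡ c a b
      distinct : ∀ {a b} → a <ᶠ b → vertex b ≢ vertex a
      avoided  : ∀ {a b} → a <ᶠ b → ρ a b (vertex a) (vertex b) ≡ false

  module _ (few : ∀ c R → # (deviant c R) ≤ σ) (0<τ : 0 < τ) (Nσ≤θτ : N * σ ≤ θ * τ) (0<M : 0 < M)
           (n₀ Kmax : ℕ) where

    -- The loss of one step apart from red neighbours: the deviation `τ`, and M times the number of
    -- deleted vertices, which are the chosen vertex itself and up to `n₀` sets of at most `τ`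
    -- exceptional ones.
    slack : ℕ
    slack = Kmax * (τ + M * (1 + n₀ * τ))

    -- After i steps K is Mⁱ: the candidate sets shrink like M⁻ⁱ, and so do the degrees inside them,
    -- so that K times either quantity changes only by the error terms.
    embed-avoiding : ∀ n {K} (c : Fin n → Fin n → Fin M) (ρ : Fin n → Fin n → Relation N) (Y : Fin n → Subset N)
      (β Δ : Fin n → ℕ) → n ≤ n₀ → 0 < K → K * M ^ n ≤ Kmax →
      (∀ {a b u} → a <ᶠ b → u ∈ˢ Y a → K * # (ρ a b u ∩ Y b) ≤ β b) →
      (∀ b → suc n * Δ b ≤ K * # (Y b)) →
      (∀ b → M * (β b + n * (Kmax * τ)) + slack ≤ Δ b) →
      (∀ b → Kmax * suc (n₀ * σ + n₀ * (n₀ * θ)) ≤ Δ b) →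
      Avoids c ρ Y
    embed-avoiding zero c ρ Y β Δ _ _ _ _ _ _ _ = record
      { vertex = λ () ; vertex∈ = λ () ; labelled = λ { {()} } ; distinct = λ { {()} } ; avoided = λ { {()} } }
    embed-avoiding (suc n) {K} c ρ Y β Δ n<n₀ 0<K KMⁿ≤Kmax degree size Δ-large Δ-pick = record
      { vertex = vertex ; vertex∈ = vertex∈ ; labelled = λ {a} {b} → labelled a b
      ; distinct = λ {a} {b} → distinct a b ; avoided = λ {a} {b} → avoided a b }
      where
      open ≤-Reasoning
      n≤n₀ : n ≤ n₀
      n≤n₀ = ≤-trans (n≤1+n n) n<n₀
      K≤Kmax : K ≤ Kmax
      K≤Kmax = ≤-trans (m≤m*n K (M ^ suc n) {{m^n≢0 M (suc n) {{>-nonZero 0<M}}}}) KMⁿ≤Kmax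

      -- Choosing v restricts the future neighbourhood of `u` to a label class of v. The vertex `u`
      -- is exceptional if this neighbourhood does not shrink by about the expected factor M.
      exceptional : Fin n → Fin n → Relation N
      exceptional a b v u = deviant (c zero (suc b)) (ρ (suc a) (suc b) u ∩ Y (suc b)) v

      bad₁ : Fin n → Subset N
      bad₁ b = deviant (c zero (suc b)) (Y (suc b))
      bad₂ : Fin n → Fin n → Subset N
      bad₂ a b v = ⌊ τ <? # (exceptional a b v) ⌋
      bad₁? : ∀ v → Dec (∃[ b ] v ∈ˢ bad₁ b)
      bad₁? v = any? (λ b → bad₁ b v ≟ᵇ true)
      bad₂? : ∀ v → Dec (∃[ a ] ∃[ b ] v ∈ˢ bad₂ a b)
      bad₂? v = any? (λ a → any? (λ b → bad₂ a b v ≟ᵇ true))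
      bad : Subset N
      bad v = ⌊ bad₁? v ⌋ ∨ ⌊ bad₂? v ⌋

      -- Each `u` is exceptional for at most `σ` choices of v, so there are at most N * σ
      -- exceptional pairs; Markov's inequality over v does the rest.
      few₂ : ∀ a b → # (bad₂ a b) ≤ θ
      few₂ a b = *-cancelʳ-≤ _ _ τ {{>-nonZero 0<τ}} (begin
        # (bad₂ a b) * τ                             ≤⟨ markov (λ v → # (exceptional a b v)) τ ⟩
        sum (λ v → # (exceptional a b v))            ≡⟨ #-swap (exceptional a b) ⟩
        sum (λ u → # (λ v → exceptional a b v u))
          ≤⟨ sum-≤-const σ (λ u → few (c zero (suc b)) (ρ (suc a) (suc b) u ∩ Y (suc b))) ⟩
        N * σ                                        ≤⟨ Nσ≤θτ ⟩
        θ * τ                                        ∎)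

      bad-few : # bad ≤ n₀ * σ + n₀ * (n₀ * θ)
      bad-few = begin
        # bad
          ≤⟨ #-union {R = λ v → ⌊ bad₁? v ⌋} {S = λ v → ⌊ bad₂? v ⌋} (λ {v} → ∨-elim ⌊ bad₁? v ⌋ ⌊ bad₂? v ⌋) ⟩
        # (λ v → ⌊ bad₁? v ⌋) + # (λ v → ⌊ bad₂? v ⌋)                  ≤⟨ +-mono-≤
          (#-cover bad₁ (λ {v} → ⌊⌋-true (bad₁? v)))
          (#-cover (λ a v → ⌊ any? (λ b → bad₂ a b v ≟ᵇ true) ⌋) (λ {v} x → case ⌊⌋-true (bad₂? v) x of λ (a , y) →
            a , true-⌊⌋ (any? (λ b → bad₂ a b v ≟ᵇ true)) y)) ⟩
        sum (λ b → # (bad₁ b)) + sum (λ a → # (λ v → ⌊ any? (λ b → bad₂ a b v ≟ᵇ true) ⌋))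
          ≤⟨ +-mono-≤ (sum-≤-const σ (λ b → few (c zero (suc b)) (Y (suc b))))
               (sum-≤-const (n * θ) (λ a → ≤-trans (#-cover (bad₂ a) (λ {v} → ⌊⌋-true (any? (λ b → bad₂ a b v ≟ᵇ true))))
                 (sum-≤-const θ (few₂ a)))) ⟩
        n * σ + n * (n * θ)
          ≤⟨ +-mono-≤ (*-monoˡ-≤ σ n≤n₀) (*-mono-≤ n≤n₀ (*-monoˡ-≤ θ n≤n₀)) ⟩
        n₀ * σ + n₀ * (n₀ * θ)                                         ∎

      Kmax>0 : 0 < Kmax
      Kmax>0 = ≤-trans 0<K K≤Kmax

      pick : ∃[ v ] (v ∈ˢ Y zero × bad v ≡ false)
      pick = #-pick (Y zero) bad (≤-trans (s≤s bad-few) (*-cancelˡ-≤ Kmax {{>-nonZero Kmax>0}} (begin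
        Kmax * suc (n₀ * σ + n₀ * (n₀ * θ))      ≤⟨ Δ-pick zero ⟩
        Δ zero                                   ≤⟨ m≤n*m (Δ zero) (suc (suc n)) ⟩
        suc (suc n) * Δ zero                     ≤⟨ size zero ⟩
        K * # (Y zero)                           ≤⟨ *-monoˡ-≤ (# (Y zero)) K≤Kmax ⟩
        Kmax * # (Y zero)                        ∎)))

      v : Fin N
      v = proj₁ pick

      ¬bad₁ : ∀ b → bad₁ b v ≡ false
      ¬bad₁ b = ≢true (λ x → ⌊⌋-false (bad₁? v) (proj₁ (∨-false (proj₂ (proj₂ pick)))) (b , x))

      few-exceptions : ∀ a b → # (exceptional a b v) ≤ τ
      few-exceptions a b = ≮⇒≥ (λ lt → ⌊⌋-false (bad₂? v) (proj₂ (∨-false {⌊ bad₁? v ⌋} (proj₂ (proj₂ pick))))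
        (a , b , true-⌊⌋ (τ <? _) lt))

      exceptional? : ∀ a u → Dec (∃[ b ] u ∈ˢ exceptional a b v)
      exceptional? a u = any? (λ b → exceptional a b v u ≟ᵇ true)

      keep : Fin n → Subset N
      keep b u = not ⌊ u ≟ v ⌋ ∧ not (ρ zero (suc b) v u) ∧ not ⌊ exceptional? b u ⌋

      Y′ : Fin n → Subset N
      Y′ b = (link (c zero (suc b)) v ∩ Y (suc b)) ∩ keep b

      record Kept (b : Fin n) (u : Fin N) : Set where
        field
          was    : u ∈ˢ Y (suc b)
          linked : u ∈ˢ link (c zero (suc b)) v
          apart  : u ≢ v
          unseen : ρ zero (suc b) v u ≡ false
          tame   : ∀ b′ → exceptional b b′ v u ≡ false

      kept : ∀ {b u} → u ∈ˢ Y′ b → Kept b u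
      kept {b} {u} x = record
        { was = proj₂ (∧-split {link (c zero (suc b)) v u} y) ; linked = proj₁ (∧-split {link (c zero (suc b)) v u} y)
        ; apart = ⌊⌋-false (u ≟ v) (not-true (proj₁ (∧-split {not ⌊ u ≟ v ⌋} z))) ; unseen = not-true (proj₁ (∧-split {not (ρ zero (suc b) v u)} q))
        ; tame = λ b′ → ≢true (λ e → ⌊⌋-false (exceptional? b u) (not-true (proj₂ (∧-split {not (ρ zero (suc b) v u)} q))) (b′ , e)) }
        where
        y = proj₁ (∧-split {(link (c zero (suc b)) v ∩ Y (suc b)) u} x)
        z = proj₂ (∧-split {(link (c zero (suc b)) v ∩ Y (suc b)) u} x)
        q = proj₂ (∧-split {not ⌊ u ≟ v ⌋} z)

      sort-out : ∀ b {u} → u ∈ˢ (link (c zero (suc b)) v ∩ Y (suc b)) →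
                 u ∈ˢ Y′ b ⊎ ⌊ u ≟ v ⌋ ∨ (ρ zero (suc b) v ∩ Y (suc b)) u ∨ ⌊ exceptional? b u ⌋ ≡ true
      sort-out b {u} = classify (link (c zero (suc b)) v u) (Y (suc b) u) ⌊ u ≟ v ⌋ (ρ zero (suc b) v u) ⌊ exceptional? b u ⌋

      linked-size : ∀ b → # (link (c zero (suc b)) v ∩ Y (suc b)) ≤
                          # (Y′ b) + (1 + (# (ρ zero (suc b) v ∩ Y (suc b)) + n * τ))
      linked-size b = begin
        # (link (c zero (suc b)) v ∩ Y (suc b))
          ≤⟨ #-union (sort-out b) ⟩
        # (Y′ b) + # (λ u → ⌊ u ≟ v ⌋ ∨ (ρ zero (suc b) v ∩ Y (suc b)) u ∨ ⌊ exceptional? b u ⌋)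
          ≤⟨ +-monoʳ-≤ (# (Y′ b)) (#-union (λ {u} → ∨-elim ⌊ u ≟ v ⌋ _)) ⟩
        # (Y′ b) + (# (λ u → ⌊ u ≟ v ⌋) + # (λ u → (ρ zero (suc b) v ∩ Y (suc b)) u ∨ ⌊ exceptional? b u ⌋))
          ≤⟨ +-monoʳ-≤ (# (Y′ b)) (+-mono-≤ (≤-reflexive (trans (#-sum (λ u → ⌊ u ≟ v ⌋)) (sum-δ v)))
               (≤-trans (#-union (λ {u} → ∨-elim ((ρ zero (suc b) v ∩ Y (suc b)) u) _)) (+-monoʳ-≤ (# (ρ zero (suc b) v ∩ Y (suc b)))
                 (≤-trans (#-cover (λ b′ → exceptional b b′ v) (λ {u} → ⌊⌋-true (exceptional? b u))) (sum-≤-const τ (few-exceptions b)))))) ⟩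
        # (Y′ b) + (1 + (# (ρ zero (suc b) v ∩ Y (suc b)) + n * τ)) ∎

      -- One `Δ` is the budget of one step. It pays for the red neighbours of v, counted M times
      -- because they are removed from a label class of relative size 1 / M, and for `slack`.
      -- Starting from `suc n` budgets leaves one at the end, so a vertex can always be picked.
      size′ : ∀ b → suc n * Δ (suc b) ≤ K * M * # (Y′ b)
      size′ b = +-cancelʳ-≤ (Δ (suc b)) _ _ (begin
        suc n * Δ (suc b) + Δ (suc b)                              ≡⟨ +-comm (suc n * Δ (suc b)) (Δ (suc b)) ⟩
        suc (suc n) * Δ (suc b)                                    ≤⟨ size (suc b) ⟩
        K * # (Y (suc b))
          ≤⟨ *-monoʳ-≤ K (≤-trans (m≤n+∣n-m∣ (# (Y (suc b))) (M * x)) (+-monoʳ-≤ (M * x) (¬deviant (¬bad₁ b)))) ⟩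
        K * (M * x + τ)
          ≤⟨ *-monoʳ-≤ K (+-monoˡ-≤ τ (*-monoʳ-≤ M (linked-size b))) ⟩
        K * (M * (y + (1 + (z + n * τ))) + τ)                      ≡⟨ regroup K M y z (n * τ) τ ⟩
        K * M * y + (M * (K * z) + K * (τ + M * (1 + n * τ)))      ≤⟨ +-monoʳ-≤ (K * M * y) (+-mono-≤
          (*-monoʳ-≤ M (≤-trans (degree z<s (proj₁ (proj₂ pick))) (m≤m+n (β (suc b)) _)))
          (*-mono-≤ K≤Kmax (+-monoʳ-≤ τ (*-monoʳ-≤ M (s≤s (*-monoˡ-≤ τ n≤n₀)))))) ⟩
        K * M * y + (M * (β (suc b) + suc n * (Kmax * τ)) + slack) ≤⟨ +-monoʳ-≤ (K * M * y) (Δ-large (suc b)) ⟩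
        K * M * y + Δ (suc b)                                      ∎)
        where
        x = # (link (c zero (suc b)) v ∩ Y (suc b))
        y = # (Y′ b)
        z = # (ρ zero (suc b) v ∩ Y (suc b))
        regroup : ∀ k m y z e t → k * (m * (y + (1 + (z + e))) + t) ≡ k * m * y + (m * (k * z) + k * (t + m * (1 + e)))
        regroup = solve-∀

      -- As `u` is not exceptional, M times its new degree exceeds its old degree by at most `τ`.
      degree′ : ∀ {a b u} → a <ᶠ b → u ∈ˢ Y′ a → K * M * # (ρ (suc a) (suc b) u ∩ Y′ b) ≤ β (suc b) + Kmax * τ
      degree′ {a} {b} {u} a<b u∈ = begin
        K * M * # (ρ (suc a) (suc b) u ∩ Y′ b)        ≤⟨ *-monoʳ-≤ (K * M) (#-mono inside) ⟩
        K * M * # (link (c zero (suc b)) v ∩ R)       ≡⟨ *-assoc K M _ ⟩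
        K * (M * # (link (c zero (suc b)) v ∩ R))
          ≤⟨ *-monoʳ-≤ K (≤-trans (m≤n+∣m-n∣ _ (# R)) (+-monoʳ-≤ (# R) (¬deviant (Kept.tame (kept u∈) b)))) ⟩
        K * (# R + τ)                                 ≡⟨ *-distribˡ-+ K (# R) τ ⟩
        K * # R + K * τ
          ≤⟨ +-mono-≤ (degree (s<s a<b) (Kept.was (kept u∈))) (*-monoˡ-≤ τ K≤Kmax) ⟩
        β (suc b) + Kmax * τ                          ∎
        where
        R = ρ (suc a) (suc b) u ∩ Y (suc b)
        inside : (ρ (suc a) (suc b) u ∩ Y′ b) ⊆ˢ (link (c zero (suc b)) v ∩ R)
        inside {w} x = ∧-join (Kept.linked k) (∧-join (proj₁ (∧-split {ρ (suc a) (suc b) u w} {Y′ b w} x)) (Kept.was k))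
          where
          k : Kept b w
          k = kept (proj₂ (∧-split {ρ (suc a) (suc b) u w} {Y′ b w} x))

      rest : Avoids (λ a b → c (suc a) (suc b)) (λ a b → ρ (suc a) (suc b)) Y′
      rest = embed-avoiding n {K * M} _ _ Y′ (λ b → β (suc b) + Kmax * τ) (λ b → Δ (suc b)) n≤n₀
        (*-mono-≤ 0<K 0<M) (≤-trans (≤-reflexive (*-assoc K M (M ^ n))) KMⁿ≤Kmax) degree′ size′
        (λ b → ≤-trans (≤-reflexive (cong (λ e → M * e + slack) (+-assoc (β (suc b)) (Kmax * τ) (n * (Kmax * τ))))) (Δ-large (suc b)))
        (λ b → Δ-pick (suc b))
      module Rest = Avoids rest

      vertex : Fin (suc n) → Fin N
      vertex zero    = v
      vertex (suc b) = Rest.vertex b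
      vertex∈ : ∀ b → vertex b ∈ˢ Y b
      vertex∈ zero    = proj₁ (proj₂ pick)
      vertex∈ (suc b) = Kept.was (kept (Rest.vertex∈ b))
      labelled : ∀ a b → a <ᶠ b → lab (vertex a) (vertex b) ≡ c a b
      labelled zero    (suc b) _         = ⌊⌋-true (_ ≟ _) (Kept.linked (kept (Rest.vertex∈ b)))
      labelled (suc a) (suc b) (s≤s a<b) = Rest.labelled a<b
      distinct : ∀ a b → a <ᶠ b → vertex b ≢ vertex a
      distinct zero    (suc b) _         = Kept.apart (kept (Rest.vertex∈ b))
      distinct (suc a) (suc b) (s≤s a<b) = Rest.distinct a<b
      avoided : ∀ a b → a <ᶠ b → ρ a b (vertex a) (vertex b) ≡ false
      avoided zero    (suc b) _         = Kept.unseen (kept (Rest.vertex∈ b))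
      avoided (suc a) (suc b) (s≤s a<b) = Rest.avoided a<b

-- A missing red pattern forces the blue ones.

-- Only pairs a < b are consulted, so `p` and `edge` need not be symmetric. The colour is required
-- on edges, the order on all pairs.
record OrderedCopy {N M n m} (lab : Fin N → Fin N → Fin M) (col : Fin N → Fin N → Bool) (c : Bool)
                   (p : Fin n → Fin n → Fin m) (edge : Fin n → Fin n → Bool) (f : Fin n → Fin N) : Set where
  field
    distinct : ∀ a b → a <ᶠ b → f a ≢ f b
    coloured : ∀ a b → a <ᶠ b → edge a b ≡ true → col (f a) (f b) ≡ c
    ordered  : ∀ a b → a <ᶠ b → ∀ a′ b′ → a′ <ᶠ b′ → p a b <ᶠ p a′ b′ → lab (f a) (f b) <ᶠ lab (f a′) (f b′)

module Dichotomy {N M : ℕ} (lab : Fin N → Fin N → Fin M) (lab-sym : ∀ u v → lab u v ≡ lab v u) (σ τ θ : ℕ)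
                 (few : ∀ c R → # (λ w → ⌊ τ <? ∣ M * # ((λ v → ⌊ lab w v ≟ c ⌋) ∩ R) - # R ∣ ⌋) ≤ σ)
                 (0<τ : 0 < τ) (Nσ≤θτ : N * σ ≤ θ * τ) (0<M : 0 < M)
                 (col : Fin N → Fin N → Bool) (col-sym : ∀ u v → col u v ≡ col v u) where

  module Emb = SparseEmbedding lab σ τ θ

  -- `Embeds` does not ask for injectivity; excluding the diagonal supplies it.
  red : Relation N
  red u v = not ⌊ u ≟ v ⌋ ∧ col u v

  red-intro : ∀ {u v} → u ≢ v → col u v ≡ true → v ∈ˢ red u
  red-intro {u} {v} u≢v c = ∧-join (cong not (false-⌊⌋ (u ≟ v) u≢v)) c

  red-elim : ∀ {u v} → v ∈ˢ red u → u ≢ v × col u v ≡ true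
  red-elim {u} {v} x = ⌊⌋-false (u ≟ v) (not-true (proj₁ (∧-split {not ⌊ u ≟ v ⌋} x))) , proj₂ (∧-split {not ⌊ u ≟ v ⌋} x)

  red-sym : ∀ {u v} → v ∈ˢ red u → u ∈ˢ red v
  red-sym {u} {v} x = red-intro (λ eq → proj₁ (red-elim {u} {v} x) (sym eq)) (trans (col-sym v u) (proj₂ (red-elim {u} {v} x)))

  open SparseFamilies red (λ {u} {v} → red-sym {u} {v}) (λ u v → toℕ (lab u v)) (λ u v → cong toℕ (lab-sym u v))

  errors : ℕ → ℕ
  errors n = M * (n * (M ^ n * τ)) + (Emb.slack few 0<τ Nσ≤θτ 0<M n (M ^ n) + M ^ n * suc (n * σ + n * (n * θ)))

  module _ {n m k E : ℕ} (labels : m ^ (2 ^ k) ≡ M) (n≤E : n ≤ E)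
           (p : Fin n → Fin n → Fin m) (free : ∀ f → ¬ OrderedCopy lab col true p (λ _ _ → true) f) where

    private
      -- The blue embedding needs parts of size suc n * (M * β + errors) with β at most a 1 / Φ
      -- fraction of the part. This Φ makes the first summand at most half of the part, and `S`
      -- covers the second one with the other half. The inner `suc` keeps `S` positive.
      Φ = 2 * (suc n * M)
      S = 2 * (suc n * suc (errors n))

      0<Φ : 0 < Φ
      0<Φ = *-mono-≤ (s≤s {n = 1} z≤n) (*-mono-≤ (s≤s {n = n} z≤n) 0<M)

      -- Different ranks are given disjoint windows in increasing order, so an embedding into the
      -- windows would be an ordered red copy.
      no-embedding : ∀ lo w V → ¬ Embeds (λ a b → within (lo + toℕ (p a b) * w) w) V
      no-embedding lo w V (f , _ , rel) = free f (record
        { distinct = λ a b a<b → proj₁ (red-elim {f a} {f b} (proj₁ (in-window a<b)))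
        ; coloured = λ a b a<b _ → proj₂ (red-elim {f a} {f b} (proj₁ (in-window a<b)))
        ; ordered = λ a b a<b a′ b′ a′<b′ lt → begin-strict
            toℕ (lab (f a) (f b))                 <⟨ proj₂ (proj₂ (in-window a<b)) ⟩
            lo + toℕ (p a b) * w + w              ≤⟨ subwindow lo (toℕ (p a′ b′)) w lt ⟩
            lo + toℕ (p a′ b′) * w                ≤⟨ proj₁ (proj₂ (in-window a′<b′)) ⟩
            toℕ (lab (f a′) (f b′))               ∎ })
        where
        open ≤-Reasoning
        in-window : ∀ {a b} → a <ᶠ b → f b ∈ˢ red (f a) × lo + toℕ (p a b) * w ≤ toℕ (lab (f a) (f b)) ×
                                       toℕ (lab (f a) (f b)) < lo + toℕ (p a b) * w + w
        in-window {a} {b} a<b = within-elim {lo + toℕ (p a b) * w} {w} {f a} {f b} (rel a<b)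

    -- With `κ` non-increasing, each later vertex goes to an earlier part of the family or to the
    -- same part, and sparseness from later to earlier parts suffices. The pattern `q` is unrelated
    -- to `p`: one missing red pattern serves for all blue ones.
    blue-copy : 2 ^ k * Φ ≤ E → (2 * E ^ n) ^ k * S ≤ N →
                (q : Fin n → Fin n → Fin m) (κ : Fin n → ℕ) → (∀ a → κ a < 2 ^ k) → (∀ {a b} → a <ᶠ b → κ b ≤ κ a) →
                ∃[ f ] OrderedCopy lab col false q (λ a b → not ⌊ κ a ≟ℕ κ b ⌋) f
    blue-copy E-large N-large q κ κ< κ-anti = vertex , record
      { distinct = λ a b a<b eq → distinct a<b (sym eq)
      ; coloured = λ a b a<b e → colour a b a<b e
      ; ordered = λ a b a<b a′ b′ a′<b′ lt → subst₂ _<_ (sym (label≡ a b a<b)) (sym (label≡ a′ b′ a′<b′)) (+-monoʳ-< base lt)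
      }
      where
      open ≤-Reasoning
      full : Subset N
      full _ = true
      #full : # full ≡ N
      #full = trans (#-sum full) (trans (sum-const N 1) (*-identityʳ N))
      family : SparseFamily Φ S (2 ^ k) 0 (m ^ (depth k + 1)) (m ^ 1) full
      -- Taking d = 1 leaves a window of m labels, one for each rank, so labels can be prescribed
      -- exactly. As depth k + 1 = 2 ^ k, the initial window is the whole label set.
      family = sparse-family p n≤E 0<Φ (s≤s z≤n) no-embedding k 1 0 full E-large (≤-trans N-large (≤-reflexive (sym #full)))
      open SparseFamily family
      label< : ∀ a b → base + toℕ (q a b) < M
      label< a b = begin-strict
        base + toℕ (q a b)         <⟨ +-monoʳ-< base (toℕ<n (q a b)) ⟩
        base + m                   ≡⟨ cong (base +_) (*-identityʳ m) ⟨
        base + m ^ 1               ≤⟨ base≤hi ⟩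
        m ^ (depth k + 1)          ≡⟨ cong (m ^_) (trans (+-comm (depth k) 1) (suc-depth k)) ⟩
        m ^ (2 ^ k)                ≡⟨ labels ⟩
        M                          ∎
      c : Fin n → Fin n → Fin M
      c a b = fromℕ< (label< a b)
      ρ : Fin n → Fin n → Relation N
      -- Nothing is known about red inside one part, so nothing is avoided between vertices of equal
      -- `κ`; no edge of the pattern joins them.
      ρ a b u v = not ⌊ κ a ≟ℕ κ b ⌋ ∧ within base (m ^ 1) u v
      Y : Fin n → Subset N
      Y b = part (κ b)
      instance _ = >-nonZero 0<Φ
      β Δ : Fin n → ℕ
      β b = # (Y b) / Φ
      Δ b = M * β b + errors n
      degree : ∀ {a b u} → a <ᶠ b → u ∈ˢ Y a → 1 * # (ρ a b u ∩ Y b) ≤ β b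
      degree {a} {b} {u} a<b u∈ = ≤-trans (≤-reflexive (*-identityˡ _)) (case κ a ≟ℕ κ b of λ
        { (yes eq) → ≤-trans (≤-reflexive (#-none (λ v → cong (λ x → (not x ∧ within base (m ^ 1) u v) ∧ Y b v) (true-⌊⌋ (κ a ≟ℕ κ b) eq)))) z≤n
        ; (no neq) → ≤-trans (#-mono (λ {v} x → ∧-join (proj₂ (∧-split {not ⌊ κ a ≟ℕ κ b ⌋} (proj₁ (∧-split {ρ a b u v} x)))) (proj₂ (∧-split {ρ a b u v} x))))
            (≤-trans (≤-reflexive (sym (m*n/n≡m _ Φ))) (/-monoˡ-≤ Φ (≤-trans (≤-reflexive (*-comm _ Φ))
              (sparse (≤∧≢⇒< (κ-anti a<b) (λ eq → neq (sym eq))) (κ< a) u∈)))) })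
      size : ∀ b → suc n * Δ b ≤ 1 * # (Y b)
      size b = *-cancelˡ-≤ 2 (begin
        2 * (suc n * (M * β b + errors n))              ≡⟨ regroup (suc n) M (β b) (errors n) ⟩
        β b * Φ + 2 * (suc n * errors n)
          ≤⟨ +-mono-≤ (m/n*n≤m (# (Y b)) Φ) (*-monoʳ-≤ 2 (*-monoʳ-≤ (suc n) (n≤1+n (errors n)))) ⟩
        # (Y b) + S                                     ≤⟨ +-monoʳ-≤ (# (Y b)) (large (κ< b)) ⟩
        # (Y b) + # (Y b)                               ≡⟨ double (# (Y b)) ⟩
        2 * (1 * # (Y b))                               ∎)
        where
        regroup : ∀ s m b e → 2 * (s * (m * b + e)) ≡ b * (2 * (s * m)) + 2 * (s * e)
        regroup = solve-∀
        double : ∀ x → x + x ≡ 2 * (1 * x)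
        double = solve-∀
      Δ-large : ∀ b → M * (β b + n * (M ^ n * τ)) + Emb.slack few 0<τ Nσ≤θτ 0<M n (M ^ n) ≤ Δ b
      Δ-large b = ≤-trans (≤-reflexive (regroup M (β b) (n * (M ^ n * τ)) _)) (+-monoʳ-≤ (M * β b) (+-monoʳ-≤ (M * (n * (M ^ n * τ))) (m≤m+n _ _)))
        where
        regroup : ∀ m b e s → m * (b + e) + s ≡ m * b + (m * e + s)
        regroup = solve-∀
      Δ-pick : ∀ b → M ^ n * suc (n * σ + n * (n * θ)) ≤ Δ b
      Δ-pick b = ≤-trans (m≤n+m _ _) (≤-trans (m≤n+m _ (M * (n * (M ^ n * τ)))) (m≤n+m (errors n) (M * β b)))
      avoids : Emb.Avoids c ρ Y
      avoids = Emb.embed-avoiding few 0<τ Nσ≤θτ 0<M n (M ^ n) n {1} c ρ Y β Δ ≤-refl (s≤s z≤n)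
        (≤-reflexive (*-identityˡ (M ^ n))) (λ {a} {b} {u} → degree {a} {b} {u}) size Δ-large Δ-pick
      open Emb.Avoids avoids
      label≡ : ∀ a b → a <ᶠ b → toℕ (lab (vertex a) (vertex b)) ≡ base + toℕ (q a b)
      label≡ a b a<b = trans (cong toℕ (labelled a<b)) (toℕ-fromℕ< (label< a b))
      colour : ∀ a b → a <ᶠ b → not ⌊ κ a ≟ℕ κ b ⌋ ≡ true → col (vertex a) (vertex b) ≡ false
      colour a b a<b e = ≢true (λ is-red → case trans (sym (avoided a<b)) (∧-join e
        (within-intro {base} {m ^ 1} {vertex a} {vertex b} (red-intro (λ eq → distinct a<b (sym eq)) is-red)
          (≤-trans (m≤m+n base _) (≤-reflexive (sym (label≡ a b a<b))))
          (≤-<-trans (≤-reflexive (label≡ a b a<b)) (+-monoʳ-< base (≤-trans (toℕ<n (q a b)) (≤-reflexive (sym (*-identityʳ m)))))))) of λ ())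

-- Sorting by colour, and exhaustive search.

argmax : ∀ {n} (κ : Fin (suc n) → ℕ) → ∃[ i ] (∀ j → κ j ≤ κ i)
argmax {zero}  κ = zero , λ { zero → ≤-refl }
argmax {suc n} κ with argmax (λ j → κ (suc j))
... | i , max with ≤-total (κ zero) (κ (suc i))
...   | inj₁ le = suc i , λ { zero → le ; (suc j) → max j }
...   | inj₂ ge = zero , λ { zero → ≤-refl ; (suc j) → ≤-trans (max j) ge }

-- A right inverse of `π` is enough: it makes `position` injective, and that is what turns an
-- embedding of positions into one of vertices.
record Sorting {n} (κ : Fin n → ℕ) : Set where
  field
    π          : Fin n → Fin n
    position   : Fin n → Fin n
    π-position : ∀ a → π (position a) ≡ a
    decreasing : ∀ a b → a <ᶠ b → κ (π b) ≤ κ (π a)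

sorting : ∀ {n} (κ : Fin n → ℕ) → Sorting κ
sorting {zero}  κ = record { π = λ () ; position = λ () ; π-position = λ () ; decreasing = λ () }
sorting {suc n} κ with argmax κ
... | i , max = record { π = π′ ; position = position′ ; π-position = π-position′ ; decreasing = decreasing′ }
  where
  open Sorting (sorting (λ j → κ (punchIn i j)))
  π′ position′ : Fin (suc n) → Fin (suc n)
  π′ zero    = i
  π′ (suc a) = punchIn i (π a)
  position′ a with i ≟ a
  ... | yes _  = zero
  ... | no i≢a = suc (position (punchOut i≢a))
  π-position′ : ∀ a → π′ (position′ a) ≡ a
  π-position′ a with i ≟ a
  ... | yes eq = eq
  ... | no i≢a = trans (cong (punchIn i) (π-position (punchOut i≢a))) (punchIn-punchOut i≢a)
  decreasing′ : ∀ a b → a <ᶠ b → κ (π′ b) ≤ κ (π′ a)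
  decreasing′ zero    (suc b) _         = max (punchIn i (π b))
  decreasing′ (suc a) (suc b) (s≤s a<b) = decreasing a b a<b

-- Search over functions is carried out on vectors; predicates that respect pointwise equality are
-- transferred back by `lookup` and `tabulate`.
anyVec? : ∀ {A : Set} → (∀ {P : A → Set} → (∀ x → Dec (P x)) → Dec (∃ P)) →
          ∀ {n} {P : Vec A n → Set} → (∀ xs → Dec (P xs)) → Dec (∃ P)
anyVec? anyA? {zero} P? with P? []
... | yes p = yes ([] , p)
... | no ¬p = no λ { ([] , p) → ¬p p }
anyVec? anyA? {suc n} P? with anyA? (λ x → anyVec? anyA? (λ xs → P? (x ∷ xs)))
... | yes (x , xs , p) = yes (x ∷ xs , p)
... | no none          = no λ { (x ∷ xs , p) → none (x , xs , p) }

sum-mono-< : ∀ {n} {f g : Fin n → ℕ} → (∀ i → f i ≤ g i) → ∀ i → f i < g i → sum f < sum g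
sum-mono-< {suc n} {f} {g} f≤g zero    lt = +-mono-<-≤ lt (sum-mono (λ j → f≤g (suc j)))
sum-mono-< {suc n} {f} {g} f≤g (suc i) lt = +-mono-≤-< (f≤g zero) (sum-mono-< (λ j → f≤g (suc j)) i lt)

#-mono-< : ∀ {N} {P R : Subset N} → P ⊆ˢ R → ∀ i → P i ≡ false → i ∈ˢ R → # P < # R
#-mono-< {P = P} {R} P⊆R i i∉P i∈R = subst₂ _<_ (sym (#-sum P)) (sym (#-sum R))
  (sum-mono-< below i (subst₂ (λ x y → ⟦ x ⟧ < ⟦ y ⟧) (sym i∉P) (sym i∈R) (s≤s z≤n)))
  where
  below : ∀ j → ⟦ P j ⟧ ≤ ⟦ R j ⟧
  below j with P j in eq
  ... | false = z≤n
  ... | true  rewrite P⊆R eq = ≤-refl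

-- Edge ranks and the complete host graph.

module Ranking {n m} (H : EOGraph n) (n²<m : n * n < m) where

  below : ℕ → Fin n → Subset n
  below L x y = adj H x y ∧ ⌊ label H x y <? L ⌋

  -- This counts ordered pairs, hence every smaller edge twice. The values need not be consecutive:
  -- only their order and the bound n * n matter.
  rankℕ : ℕ → ℕ
  rankℕ L = sum (λ x → # (below L x))

  rankℕ<m : ∀ L → rankℕ L < m
  rankℕ<m L = ≤-<-trans (sum-≤-const n (λ x → #≤N (below L x))) n²<m

  -- The growth is strict because the pair x, y is counted below L′ but not below its own label.
  rankℕ-mono : ∀ {L L′} x y → adj H x y ≡ true → label H x y ≡ L → L < L′ → rankℕ L < rankℕ L′
  rankℕ-mono {L} {L′} x y xy refl L<L′ = sum-mono-< (λ z → #-mono (grow z)) x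
    (#-mono-< (grow x) y (trans (cong (adj H x y ∧_) (false-⌊⌋ (label H x y <? L) (<-irrefl refl)))
                                (cong (_∧ false) xy))
      (∧-join xy (true-⌊⌋ (_ <? _) L<L′)))
    where
    grow : ∀ z → below L z ⊆ˢ below L′ z
    grow z {w} e = ∧-join (proj₁ (∧-split {adj H z w} e))
      (true-⌊⌋ (_ <? _) (<-trans (⌊⌋-true (label H z w <? L) (proj₂ (∧-split {adj H z w} e))) L<L′))

  rank : Fin n → Fin n → Fin m
  rank u v = fromℕ< (rankℕ<m (label H u v))

  rank-sym : ∀ u v → rank u v ≡ rank v u
  rank-sym u v = toℕ-injective (trans (toℕ-fromℕ< _) (trans (cong rankℕ (label-sym H u v)) (sym (toℕ-fromℕ< _))))

  rank-mono : ∀ {u v x y} → adj H u v ≡ true → label H u v < label H x y → rank u v <ᶠ rank x y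
  rank-mono {u} {v} uv lt = subst₂ _<_ (sym (toℕ-fromℕ< _)) (sym (toℕ-fromℕ< _)) (rankℕ-mono u v uv refl lt)

module Complete {N M} (lab : Fin N → Fin N → Fin M) (lab-sym : ∀ u v → lab u v ≡ lab v u) where

  pair : Fin N → Fin N → Fin (N * N)
  pair u v with u ≤ᶠ? v
  ... | yes _ = combine u v
  ... | no _  = combine v u

  pair-sym : ∀ u v → pair u v ≡ pair v u
  pair-sym u v with u ≤ᶠ? v | v ≤ᶠ? u
  ... | yes u≤v | yes v≤u = cong₂ combine (≤ᶠ-antisym u≤v v≤u) (≤ᶠ-antisym v≤u u≤v)
  ... | yes _   | no _    = refl
  ... | no _    | yes _   = refl
  ... | no u≰v  | no v≰u  = contradiction (<⇒≤ (≰⇒> u≰v)) v≰u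

  pair-injective : ∀ u v x y → pair u v ≡ pair x y → (u ≡ x × v ≡ y) ⊎ (u ≡ y × v ≡ x)
  pair-injective u v x y eq with u ≤ᶠ? v | x ≤ᶠ? y
  ... | yes _ | yes _ = inj₁ (combine-injective u v x y eq)
  ... | yes _ | no _  = inj₂ (combine-injective u v y x eq)
  ... | no _  | yes _ = inj₂ (swapˣ (combine-injective v u x y eq))
  ... | no _  | no _  = inj₁ (swapˣ (combine-injective v u y x eq))

  complete : EOGraph N
  complete = record
    { adj = λ u v → not ⌊ u ≟ v ⌋
    ; adj-irr = λ v → cong not (true-⌊⌋ (v ≟ v) refl)
    ; adj-sym = λ u v → cong not (≟-sym u v)
    -- Lexicographic order: the coarse label decides, and the code of the unordered pair only breaks
    -- ties.
    ; label = λ u v → toℕ (combine (lab u v) (pair u v))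
    ; label-sym = λ u v → cong toℕ (cong₂ combine (lab-sym u v) (pair-sym u v))
    ; label-inj = λ u v x y _ _ eq → pair-injective u v x y
        (proj₂ (combine-injective (lab u v) (pair u v) (lab x y) (pair x y) (toℕ-injective eq)))
    }
    where
    ≟-sym : ∀ (u v : Fin N) → ⌊ u ≟ v ⌋ ≡ ⌊ v ≟ u ⌋
    ≟-sym u v with u ≟ v | v ≟ u
    ... | yes _  | yes _  = refl
    ... | yes eq | no ne  = contradiction (sym eq) ne
    ... | no ne  | yes eq = contradiction (sym eq) ne
    ... | no _   | no _   = refl

  module _ {n m} (H : EOGraph n) (n²<m : n * n < m) where
    open Ranking H n²<m

    mono-copy : ∀ (χ : Colouring complete) {c edge f} (π position : Fin n → Fin n) → (∀ a → π (position a) ≡ a) →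
                (∀ a b → adj H (π a) (π b) ≡ true → edge a b ≡ true) →
                OrderedCopy lab (col χ) c (λ a b → rank (π a) (π b)) edge f → MonoCopy H complete χ c
    mono-copy χ {c} {edge} {f} π position π-position edge-intro copy = record
      { f = g
      ; f-inj = λ {u} {v} → g-injective u v
      ; f-edge = λ u v uv → cong not (false-⌊⌋ (g u ≟ g v) (λ eq → adj⇒≢ uv (g-injective u v eq)))
      ; f-colour = λ u v uv → coloured′ (direction uv)
      ; f-order = λ u v x y uv xy lt → combine-monoˡ-< (pair (g u) (g v)) (pair (g x) (g y)) (ordered′ uv lt (direction uv) (direction xy))
      }
      where
      open OrderedCopy copy
      g : Fin n → Fin N
      g u = f (position u)
      position-injective : ∀ {u v} → position u ≡ position v → u ≡ v
      position-injective {u} {v} eq = trans (sym (π-position u)) (trans (cong π eq) (π-position v))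
      g-injective : ∀ u v → g u ≡ g v → u ≡ v
      g-injective u v eq with <ᶠ-cmp (position u) (position v)
      ... | tri< lt _ _ = contradiction eq (distinct _ _ lt)
      ... | tri≈ _ p≡ _ = position-injective p≡
      ... | tri> _ _ gt = contradiction (sym eq) (distinct _ _ gt)
      adj⇒≢ : ∀ {u v} → adj H u v ≡ true → u ≢ v
      adj⇒≢ {u} uv refl = case trans (sym uv) (adj-irr H u) of λ ()
      -- An ordered copy speaks only of increasing positions. Since rank, label and colour are
      -- symmetric, every edge can be read in the increasing direction.
      record Directed (u v : Fin n) : Set where
        field
          {x y} : Fin n
          x<y   : x <ᶠ y
          is-edge : edge x y ≡ true
          rank≡ : rank (π x) (π y) ≡ rank u v
          lab≡  : lab (f x) (f y) ≡ lab (g u) (g v)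
          col≡  : col χ (f x) (f y) ≡ col χ (g u) (g v)
      forward : ∀ {u v} → adj H u v ≡ true → position u <ᶠ position v → Directed u v
      forward {u} {v} uv lt = record
        { x<y = lt ; rank≡ = cong₂ rank (π-position u) (π-position v) ; lab≡ = refl ; col≡ = refl
        ; is-edge = edge-intro _ _ (trans (cong₂ (adj H) (π-position u) (π-position v)) uv) }
      direction : ∀ {u v} → adj H u v ≡ true → Directed u v
      direction {u} {v} uv with <ᶠ-cmp (position u) (position v)
      ... | tri< lt _ _ = forward uv lt
      ... | tri≈ _ p≡ _ = contradiction (position-injective p≡) (adj⇒≢ uv)
      ... | tri> _ _ gt = record
        { x<y = D.x<y ; is-edge = D.is-edge ; rank≡ = trans D.rank≡ (rank-sym v u)
        ; lab≡ = trans D.lab≡ (lab-sym _ _) ; col≡ = trans D.col≡ (col-sym χ _ _) }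
        where module D = Directed (forward (trans (adj-sym H v u) uv) gt)
      coloured′ : ∀ {u v} → Directed u v → col χ (g u) (g v) ≡ c
      coloured′ d = trans (sym col≡) (coloured _ _ x<y is-edge)
        where open Directed d
      ordered′ : ∀ {u v x y} → adj H u v ≡ true → label H u v < label H x y → Directed u v → Directed x y →
                 lab (g u) (g v) <ᶠ lab (g x) (g y)
      ordered′ uv lt d e = subst₂ _<ᶠ_ D.lab≡ E.lab≡ (ordered _ _ D.x<y _ _ E.x<y
        (subst₂ _<ᶠ_ (sym D.rank≡) (sym E.rank≡) (rank-mono uv lt)))
        where
        module D = Directed d
        module E = Directed e

-- Deciding which patterns occur.

module _ {N M n m : ℕ} (lab : Fin N → Fin N → Fin M) (col : Fin N → Fin N → Bool) (c : Bool) where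

  RedCopy : (Fin n → Fin n → Fin m) → (Fin n → Fin N) → Set
  RedCopy p f = OrderedCopy lab col c p (λ _ _ → true) f

  redCopy? : ∀ p f → Dec (RedCopy p f)
  redCopy? p f with
    all? (λ a → all? (λ b → (a <ᶠ? b) →-dec ¬? (f a ≟ f b)))
    | all? (λ a → all? (λ b → (a <ᶠ? b) →-dec (col (f a) (f b) ≟ᵇ c)))
    | all? (λ a → all? (λ b → (a <ᶠ? b) →-dec all? (λ a′ → all? (λ b′ → (a′ <ᶠ? b′) →-dec
        ((p a b <ᶠ? p a′ b′) →-dec (lab (f a) (f b) <ᶠ? lab (f a′) (f b′)))))))
  ... | yes d | yes e | yes o = yes (record { distinct = d ; coloured = λ a b lt _ → e a b lt ; ordered = o })
  ... | no ¬d | _     | _     = no (λ r → ¬d (OrderedCopy.distinct r))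
  ... | yes _ | no ¬e | _     = no (λ r → ¬e (λ a b lt → OrderedCopy.coloured r a b lt refl))
  ... | yes _ | yes _ | no ¬o = no (λ r → ¬o (OrderedCopy.ordered r))

  redCopy-cong : ∀ {p f g} → (∀ a → f a ≡ g a) → RedCopy p f → RedCopy p g
  redCopy-cong f≡g r = record
    { distinct = λ a b lt → subst₂ _≢_ (f≡g a) (f≡g b) (distinct a b lt)
    ; coloured = λ a b lt e → trans (sym (cong₂ col (f≡g a) (f≡g b))) (coloured a b lt e)
    ; ordered = λ a b lt a′ b′ lt′ o → subst₂ _<ᶠ_ (cong₂ lab (f≡g a) (f≡g b)) (cong₂ lab (f≡g a′) (f≡g b′)) (ordered a b lt a′ b′ lt′ o)
    }
    where open OrderedCopy r

  anyRedCopy? : ∀ p → Dec (∃ (RedCopy p))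
  anyRedCopy? p with anyVec? any? (λ xs → redCopy? p (lookup xs))
  ... | yes (xs , r) = yes (lookup xs , r)
  ... | no none      = no (λ (f , r) → none (tabulate f , redCopy-cong (λ a → sym (lookup∘tabulate f a)) r))

  -- A pattern here is any table of ranks below m, so there are finitely many, although the labels
  -- of edge-ordered graphs are unbounded. This decides the colour before any graph of the family is
  -- given.
  missing-or-all : (∃[ p ] ∀ f → ¬ RedCopy p f) ⊎ (∀ p → ∃ (RedCopy p))
  missing-or-all with anyVec? (anyVec? any?) (λ xss → ¬? (anyRedCopy? (λ a b → lookup (lookup xss a) b)))
  ... | yes (xss , none) = inj₁ (_ , λ f r → none (f , r))
  ... | no all           = inj₂ found
    where
    found : ∀ p → ∃ (RedCopy p)
    found p with anyRedCopy? (λ a b → lookup (lookup (tabulate (λ a → tabulate (p a))) a) b)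
    ... | no none = contradiction (tabulate (λ a → tabulate (p a)) , none) all
    ... | yes (f , r) = f , record
      { distinct = distinct ; coloured = coloured
      ; ordered = λ a b lt a′ b′ lt′ o → ordered a b lt a′ b′ lt′ (subst₂ _<ᶠ_ (sym (eq a b)) (sym (eq a′ b′)) o) }
      where
      open OrderedCopy r
      eq : ∀ a b → lookup (lookup (tabulate (λ a → tabulate (p a))) a) b ≡ p a b
      eq a b = trans (cong (λ v → lookup v b) (lookup∘tabulate (λ a → tabulate (p a)) a)) (lookup∘tabulate (p a) b)

-- Numerical estimates.

∣_∣ᵗ : ℕ → ℕ
∣ j ∣ᵗ = CharTwoField.size (tower j)

∣+∣ᵗ : ∀ d j → ∣ d + j ∣ᵗ ≡ ∣ j ∣ᵗ ^ (2 ^ d)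
∣+∣ᵗ zero    j = sym (*-identityʳ ∣ j ∣ᵗ)
∣+∣ᵗ (suc d) j = begin
  ∣ d + j ∣ᵗ * ∣ d + j ∣ᵗ                    ≡⟨ cong₂ _*_ (∣+∣ᵗ d j) (∣+∣ᵗ d j) ⟩
  ∣ j ∣ᵗ ^ (2 ^ d) * ∣ j ∣ᵗ ^ (2 ^ d)        ≡⟨ ^-distribˡ-+-* ∣ j ∣ᵗ (2 ^ d) (2 ^ d) ⟨
  ∣ j ∣ᵗ ^ (2 ^ d + 2 ^ d)                   ≡⟨ cong (λ e → ∣ j ∣ᵗ ^ (2 ^ d + e)) (+-identityʳ (2 ^ d)) ⟨
  ∣ j ∣ᵗ ^ (2 * 2 ^ d)                       ∎
  where open ≡-Reasoning

2≤∣_∣ᵗ : ∀ j → 2 ≤ ∣ j ∣ᵗ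
2≤∣ zero ∣ᵗ  = ≤-refl
2≤∣ suc j ∣ᵗ = ≤-trans (2≤∣ j ∣ᵗ) (m≤m*n ∣ j ∣ᵗ ∣ j ∣ᵗ {{>-nonZero (≤-trans (s≤s z≤n) (2≤∣ j ∣ᵗ))}})

-- Each size is the square of the one before, so the first size reaching x is at most x².
tower-size-between : ∀ x → 2 ≤ x → ∃[ l ] (x ≤ ∣ l ∣ᵗ × ∣ l ∣ᵗ ≤ x * x)
tower-size-between (suc zero) (s≤s ())
tower-size-between (suc (suc zero)) _ = 0 , ≤-refl , s≤s (s≤s z≤n)
tower-size-between (suc x@(suc (suc y))) _ with tower-size-between x (s≤s (s≤s z≤n))
... | l , x≤ , ≤x² with suc x ≤? ∣ l ∣ᵗ
...   | yes x<  = l , x< , ≤-trans ≤x² (*-mono-≤ (n≤1+n x) (n≤1+n x))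
...   | no  x≮  = suc l , larger , *-mono-≤ (≤-trans l≤x (n≤1+n x)) (≤-trans l≤x (n≤1+n x))
  where
  l≤x : ∣ l ∣ᵗ ≤ x
  l≤x = ≤-pred (≰⇒> x≮)
  larger : suc x ≤ ∣ l ∣ᵗ * ∣ l ∣ᵗ
  larger = begin
    1 + x              ≤⟨ +-monoˡ-≤ x {1} {x} (s≤s z≤n) ⟩
    x + x              ≡⟨ double x ⟩
    x * 2              ≤⟨ *-mono-≤ x≤ (≤-trans (s≤s (s≤s z≤n)) x≤) ⟩
    ∣ l ∣ᵗ * ∣ l ∣ᵗ    ∎
    where
    open ≤-Reasoning
    double : ∀ x → x + x ≡ x * 2
    double = solve-∀

log₂-between : ∀ x → 0 < x → ∃[ e ] (2 ^ e ≤ x × x < 2 ^ suc e)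
log₂-between (suc zero) _ = 0 , s≤s z≤n , s≤s (s≤s z≤n)
log₂-between (suc x@(suc _)) _ with log₂-between x z<s
... | e , ≤x , x< with suc x <? 2 ^ suc e
...   | yes lt = e , ≤-trans ≤x (n≤1+n x) , lt
...   | no  ≮  = suc e , ≮⇒≥ ≮ , ≤-trans (s≤s x<) (+-mono-≤ (m^n>0 2 (suc e)) (≤-reflexive (sym (+-identityʳ (2 ^ suc e)))))

-- Replacing log₂ t by an integer ℓ below it reduces the real inequality to a comparison of powers
-- of n.
boundedBy : ∀ K n t ℓ N → 0 < n → 2 ^ ℓ ≤ t → N ≤ n ^ (K * ℓ) → BoundedBy K n t N
boundedBy K n t ℓ N 0<n 2^ℓ≤t N≤ p q 0<q n^p<N^q = begin-strict
  2 ^ p                  <⟨ ^-monoʳ-< 2 (s≤s (s≤s z≤n)) p<Kℓq ⟩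
  2 ^ (K * ℓ * q)        ≡⟨ cong (2 ^_) (regroup K ℓ q) ⟩
  2 ^ (ℓ * (K * q))      ≡⟨ ^-*-assoc 2 ℓ (K * q) ⟨
  (2 ^ ℓ) ^ (K * q)      ≤⟨ ^-monoˡ-≤ (K * q) 2^ℓ≤t ⟩
  t ^ (K * q)            ∎
  where
  open ≤-Reasoning
  regroup : ∀ a b c → a * b * c ≡ b * (a * c)
  regroup = solve-∀
  p<Kℓq : p < K * ℓ * q
  p<Kℓq = ≰⇒> (λ ge → <-irrefl refl (begin-strict
    n ^ p                  <⟨ n^p<N^q ⟩
    N ^ q                  ≤⟨ ^-monoˡ-≤ q N≤ ⟩
    (n ^ (K * ℓ)) ^ q      ≡⟨ ^-*-assoc n (K * ℓ) q ⟩
    n ^ (K * ℓ * q)        ≤⟨ ^-monoʳ-≤ n {{>-nonZero 0<n}} ge ⟩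
    n ^ p                  ∎))

-- With `τ` set to M * θ and P standing for M ^ n, the expression expands into eight terms, each at
-- most M³ P θ, and 8 ≤ M absorbs their number.
errors-bound : ∀ {n M P σ θ} → n ≤ M → 8 ≤ M → 0 < P → 0 < θ → σ ≤ θ →
  suc (M * (n * (P * (M * θ))) + (P * (M * θ + M * (1 + n * (M * θ))) + P * suc (n * σ + n * (n * θ)))) ≤ M ^ 4 * (P * θ)
errors-bound {n} {M} {P} {σ} {θ} n≤M 8≤M 0<P 0<θ σ≤θ = begin
  1 + (M * (n * (P * (M * θ))) + (P * (M * θ + M * (1 + n * (M * θ))) + P * (1 + (n * σ + n * (n * θ)))))
    ≤⟨ +-mono-≤ 1≤X (+-mono-≤ (*-monoʳ-≤ M (*-monoˡ-≤ (P * (M * θ)) n≤M)) (+-mono-≤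
         (*-monoʳ-≤ P (+-monoʳ-≤ (M * θ) (*-monoʳ-≤ M (+-mono-≤ 0<θ (*-monoˡ-≤ (M * θ) n≤M)))))
         (*-monoʳ-≤ P (+-mono-≤ 0<θ (+-mono-≤ (*-mono-≤ n≤M σ≤θ) (*-mono-≤ n≤M (*-monoˡ-≤ θ n≤M))))))) ⟩
  X + (M * (M * (P * (M * θ))) + (P * (M * θ + M * (θ + M * (M * θ))) + P * (θ + (M * θ + M * (M * θ)))))
    ≡⟨ expand M P θ ⟩
  X + (X + ((M * Y + M * Y + X) + (Y + M * Y + M * (M * Y))))
    ≤⟨ +-monoʳ-≤ X (+-monoʳ-≤ X (+-mono-≤ (+-monoˡ-≤ X (+-mono-≤ MY≤X MY≤X)) (+-mono-≤ (+-mono-≤ Y≤X MY≤X) MMY≤X))) ⟩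
  X + (X + ((X + X + X) + (X + X + X)))
    ≡⟨ eight X ⟩
  8 * X
    ≤⟨ *-monoˡ-≤ X 8≤M ⟩
  M * X
    ≡⟨ power M Y ⟩
  M ^ 4 * (P * θ) ∎
  where
  open ≤-Reasoning
  Y = P * θ
  X = M * (M * (M * Y))
  instance _ = >-nonZero (≤-trans (s≤s z≤n) 8≤M)
  MMY≤X : M * (M * Y) ≤ X
  MMY≤X = m≤n*m _ M
  MY≤X : M * Y ≤ X
  MY≤X = ≤-trans (m≤n*m _ M) MMY≤X
  Y≤X : Y ≤ X
  Y≤X = ≤-trans (m≤n*m _ M) MY≤X
  1≤X : 1 ≤ X
  1≤X = ≤-trans (*-mono-≤ 0<P 0<θ) Y≤X
  expand : ∀ m p t → m * (m * (m * (p * t))) + (m * (m * (p * (m * t))) + (p * (m * t + m * (t + m * (m * t))) + p * (t + (m * t + m * (m * t))))) ≡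
    m * (m * (m * (p * t))) + (m * (m * (m * (p * t))) + ((m * (p * t) + m * (p * t) + m * (m * (m * (p * t)))) + (p * t + m * (p * t) + m * (m * (p * t)))))
  expand = solve-∀
  eight : ∀ x → x + (x + ((x + x + x) + (x + x + x))) ≡ 8 * x
  eight = solve-∀
  power : ∀ m y → m * (m * (m * (m * y))) ≡ m * (m * (m * (m * 1))) * y
  power = solve-∀

-- Here E is M ^ 4, and every factor 2 and `suc n` is replaced by M. The exponent (1 + 4 n)(k + 1) +
-- 6 + n that results is at most 12 n (k + 1), with equality at n = 1, k = 0; this is the origin of
-- 12.
size-bound : ∀ {n k M θ R} → 0 < n → suc n ≤ M → 8 ≤ M → 12 * (n * suc k) ≤ R → ∀ e → suc e ≤ M ^ 4 * (M ^ n * θ) →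
             (2 * (M ^ 4) ^ n) ^ suc k * (2 * (suc n * suc e)) ≤ M ^ R * θ
size-bound {n@(suc a)} {k} {M} {θ} {R} _ n<M 8≤M R-large e e≤ = begin
  (2 * (M ^ 4) ^ n) ^ suc k * (2 * (suc n * suc e))
    ≤⟨ *-mono-≤ (^-monoˡ-≤ (suc k) (*-mono-≤ 2≤M (≤-reflexive (^-*-assoc M 4 n)))) (*-mono-≤ 2≤M (*-mono-≤ n<M e≤)) ⟩
  (M ^ (1 + 4 * n)) ^ suc k * (M * (M * (M ^ 4 * (M ^ n * θ))))
    ≡⟨ cong₂ _*_ (^-*-assoc M (1 + 4 * n) (suc k)) (regroup M (M ^ 4) (M ^ n) θ) ⟩
  M ^ ((1 + 4 * n) * suc k) * (M * (M * (M ^ 4 * M ^ n)) * θ)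
    ≡⟨ cong (λ x → M ^ ((1 + 4 * n) * suc k) * (M * (M * x) * θ)) (^-distribˡ-+-* M 4 n) ⟨
  M ^ ((1 + 4 * n) * suc k) * (M ^ (6 + n) * θ)
    ≡⟨ *-assoc (M ^ ((1 + 4 * n) * suc k)) (M ^ (6 + n)) θ ⟨
  M ^ ((1 + 4 * n) * suc k) * M ^ (6 + n) * θ
    ≡⟨ cong (_* θ) (^-distribˡ-+-* M ((1 + 4 * n) * suc k) (6 + n)) ⟨
  M ^ ((1 + 4 * n) * suc k + (6 + n)) * θ
    ≤⟨ *-monoˡ-≤ θ (^-monoʳ-≤ M {{>-nonZero (≤-trans (s≤s z≤n) 8≤M)}} (≤-trans exponent R-large)) ⟩
  M ^ R * θ ∎
  where
  open ≤-Reasoning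
  2≤M : 2 ≤ M
  2≤M = ≤-trans (s≤s (s≤s z≤n)) 8≤M
  regroup : ∀ m x y t → m * (m * (x * (y * t))) ≡ m * (m * (x * y)) * t
  regroup = solve-∀
  difference : ∀ a k → (1 + 4 * (1 + a)) * (1 + k) + (6 + (1 + a)) + (7 * a + 7 * k + 8 * (a * k)) ≡ 12 * ((1 + a) * (1 + k))
  difference = solve-∀
  exponent : (1 + 4 * n) * suc k + (6 + n) ≤ 12 * (n * suc k)
  exponent = ≤-trans (m≤m+n _ (7 * a + 7 * k + 8 * (a * k))) (≤-reflexive (difference a k))

-- Assembly and choice of parameters.

module Universality {N M : ℕ} (lab : Fin N → Fin N → Fin M) (lab-sym : ∀ u v → lab u v ≡ lab v u) (σ τ θ : ℕ)
                    (few : ∀ c R → # (λ w → ⌊ τ <? ∣ M * # ((λ v → ⌊ lab w v ≟ c ⌋) ∩ R) - # R ∣ ⌋) ≤ σ)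
                    (0<τ : 0 < τ) (Nσ≤θτ : N * σ ≤ θ * τ) (0<M : 0 < M)
                    (n m k t E : ℕ) (labels : m ^ (2 ^ k) ≡ M) (n≤E : n ≤ E) (n²<m : n * n < m) (t≤2ᵏ : t ≤ 2 ^ k)
                    (E-large : 2 ^ k * (2 * (suc n * M)) ≤ E) where

  errors : ℕ
  errors = M * (n * (M ^ n * τ)) + (M ^ n * (τ + M * (1 + n * τ)) + M ^ n * suc (n * σ + n * (n * θ)))

  open Complete lab lab-sym using (complete; mono-copy) public

  module _ (N-large : (2 * E ^ n) ^ k * (2 * (suc n * suc errors)) ≤ N) where

    blue : (χ : Colouring complete) (p : Fin n → Fin n → Fin m) → (∀ f → ¬ RedCopy lab (col χ) true p f) →
           ∀ H → ChromaticAtMost H t → MonoCopy H complete χ false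
    blue χ p free H (κ , proper) = mono-copy {n} {m} H n²<m χ π position π-position
      (λ a b ab → cong not (false-⌊⌋ (_ ≟ℕ _) (λ eq → proper (π a) (π b) ab (toℕ-injective eq)))) (proj₂ found)
      where
      open Sorting (sorting (λ a → toℕ (κ a)))
      open Ranking {n} {m} H n²<m
      found : ∃[ f ] OrderedCopy lab (col χ) false (λ a b → rank (π a) (π b))
                       (λ a b → not ⌊ toℕ (κ (π a)) ≟ℕ toℕ (κ (π b)) ⌋) f
      found = Dichotomy.blue-copy lab lab-sym σ τ θ few 0<τ Nσ≤θτ 0<M (col χ) (col-sym χ) {k = k} labels n≤E p free
        E-large N-large (λ a b → rank (π a) (π b)) (λ a → toℕ (κ (π a)))
        (λ a → <-≤-trans (toℕ<n (κ (π a))) t≤2ᵏ) (λ {a} {b} → decreasing a b)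

    red-mono : (χ : Colouring complete) → ∀ H → ∃ (RedCopy lab (col χ) true (Ranking.rank {n} {m} H n²<m)) → MonoCopy H complete χ true
    red-mono χ H (f , copy) = mono-copy {n} {m} H n²<m χ id id (λ _ → refl) (λ _ _ _ → refl) copy

    universal : RamseyUniversal complete n (F n t)
    universal χ = case missing-or-all lab (col χ) true of λ
      { (inj₁ (p , free)) → false , blue χ p free
      ; (inj₂ all)        → true , λ H _ → red-mono χ H (all (Ranking.rank {n} {m} H n²<m))
      }

    arrows : (H₁ H₂ : EOGraph n) → F n t H₂ → Arrows complete H₁ H₂
    arrows H₁ H₂ H₂∈F χ = case anyRedCopy? lab (col χ) true (Ranking.rank {n} {m} H₁ n²<m) of λ
      { (yes copy) → inj₁ (red-mono χ H₁ copy)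
      ; (no none)  → inj₂ (blue χ (Ranking.rank {n} {m} H₁ n²<m) (λ f r → none (f , r)) H₂ H₂∈F)
      }

RamseyGraph : (n t N : ℕ) → Set
RamseyGraph n t N = Σ (EOGraph N) λ G → RamseyUniversal G n (F n t) × ((H₁ H₂ : EOGraph n) → F n t H₂ → Arrows G H₁ H₂)

-- There are M = m ^ 2ᵏ⁺¹ labels, and the field has T⁴ elements, where T ≥ M ^ (12 n (k + 1)).
ramsey-graph : ∀ n k l r t → 2 ≤ n → n * (n * n) ≤ ∣ l ∣ᵗ → t ≤ 2 ^ suc k → 12 * (n * suc k) ≤ 2 ^ r →
               RamseyGraph n t ∣ 3 + (r + (suc k + l)) ∣ᵗ
ramsey-graph n k l r t 2≤n n³≤m t≤ 12nk≤2ʳ =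
  complete , universal N-large , arrows N-large
  where
  open ≤-Reasoning
  j = suc k + l
  m = ∣ l ∣ᵗ
  M = ∣ j ∣ᵗ
  T = ∣ r + j ∣ᵗ
  -- The field has T⁴ elements, so there are N = T⁸ vertices. For τ = M T⁷ the second moment bound
  -- M² T²⁰ / τ² allows T⁶ = σ deviant vertices, and θ = T⁷ gives N σ ≤ θ τ with a factor M to
  -- spare. The size requirement M ^ (2 ^ r) * θ ≤ N then reads T * T⁷ ≤ T⁸.
  σ = (T * T) * (T * T) * (T * T)
  θ = T * σ
  τ = M * θ
  module L = Labelling (tower (2 + (r + j))) M (leading (2 + r) j) (leading-balanced (2 + r) j)

  positive : ∀ i → 0 < ∣ i ∣ᵗ
  positive i = ≤-trans (s≤s z≤n) (2≤∣ i ∣ᵗ)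
  0<n : 0 < n
  0<n = ≤-trans (s≤s z≤n) 2≤n
  0<θ : 0 < θ
  0<θ = *-mono-≤ (positive (r + j)) (*-mono-≤ (*-mono-≤ T²>0 T²>0) T²>0)
    where
    T²>0 : 0 < T * T
    T²>0 = *-mono-≤ (positive (r + j)) (positive (r + j))
  0<τ : 0 < τ
  0<τ = *-mono-≤ (positive j) 0<θ

  few : ∀ c R → # (λ w → ⌊ τ <? ∣ M * # ((λ v → ⌊ L.lab w v ≟ c ⌋) ∩ R) - # R ∣ ⌋) ≤ σ
  few c R = *-cancelʳ-≤ _ _ (τ * τ) {{>-nonZero (*-mono-≤ 0<τ 0<τ)}}
    (≤-trans (L.deviant-bound c R τ) (≤-reflexive (balance M T)))
    where
    balance : ∀ M T → let Q = (T * T) * (T * T); N = Q * Q; σ = (T * T) * (T * T) * (T * T); τ = M * (T * σ) in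
              M * M * (N * (Q * N)) ≡ σ * (τ * τ)
    balance = solve-∀

  labels : m ^ (2 ^ suc k) ≡ M
  labels = sym (∣+∣ᵗ (suc k) l)
  m≤M : m ≤ M
  m≤M = begin
    m                    ≡⟨ *-identityʳ m ⟨
    m ^ 1                ≤⟨ ^-monoʳ-≤ m {{>-nonZero (positive l)}} (m^n>0 2 (suc k)) ⟩
    m ^ (2 ^ suc k)      ≡⟨ labels ⟩
    M                    ∎
  8≤M : 8 ≤ M
  8≤M = ≤-trans (*-mono-≤ 2≤n (*-mono-≤ 2≤n 2≤n)) (≤-trans n³≤m m≤M)
  n²<m : n * n < m
  n²<m = begin-strict
    n * n              <⟨ m<n+m (n * n) (*-mono-≤ 0<n 0<n) ⟩
    n * n + n * n      ≡⟨ double (n * n) ⟩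
    2 * (n * n)        ≤⟨ *-monoˡ-≤ (n * n) 2≤n ⟩
    n * (n * n)        ≤⟨ n³≤m ⟩
    m                  ∎
    where
    double : ∀ x → x + x ≡ 2 * x
    double = solve-∀
  n<M : suc n ≤ M
  n<M = ≤-trans (s≤s (m≤m*n n n {{>-nonZero 0<n}})) (≤-trans n²<m m≤M)
  2^k≤M : 2 ^ suc k ≤ M
  2^k≤M = ≤-trans (<⇒≤ (n<2^n (2 ^ suc k))) (≤-trans (^-monoˡ-≤ (2 ^ suc k) 2≤∣ l ∣ᵗ) (≤-reflexive labels))
    where
    n<2^n : ∀ x → x < 2 ^ x
    n<2^n zero    = s≤s z≤n
    n<2^n (suc x) = ≤-trans (s≤s (n<2^n x)) (+-mono-≤ (m^n>0 2 x) (≤-reflexive (sym (+-identityʳ (2 ^ x)))))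
  -- Each of the four factors is at most M, which dictates E = M⁴.
  E-large : 2 ^ suc k * (2 * (suc n * M)) ≤ M ^ 4
  E-large = ≤-trans (*-mono-≤ 2^k≤M (*-mono-≤ (≤-trans (s≤s (s≤s z≤n)) 8≤M) (*-monoˡ-≤ M n<M))) (≤-reflexive (power M))
    where
    power : ∀ m → m * (m * (m * m)) ≡ m * (m * (m * (m * 1)))
    power = solve-∀
  n≤E : n ≤ M ^ 4
  n≤E = ≤-trans (n≤1+n n) (≤-trans n<M (m≤m*n M (M * (M * (M * 1))) {{>-nonZero (m^n>0 M {{>-nonZero (positive j)}} 3)}}))
  Nσ≤θτ : L.N * σ ≤ θ * τ
  Nσ≤θτ = ≤-trans (m≤n*m (L.N * σ) M {{>-nonZero (positive j)}}) (≤-reflexive (balance M T))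
    where
    balance : ∀ M T → let Q = (T * T) * (T * T); N = Q * Q; σ = (T * T) * (T * T) * (T * T); τ = M * (T * σ) in
              M * (N * σ) ≡ (T * σ) * τ
    balance = solve-∀

  open Universality L.lab L.lab-sym σ τ θ few 0<τ Nσ≤θτ (positive j) n m (suc k) t (M ^ 4) labels n≤E n²<m t≤ E-large

  N-large : (2 * (M ^ 4) ^ n) ^ suc k * (2 * (suc n * suc errors)) ≤ L.N
  N-large = begin
    (2 * (M ^ 4) ^ n) ^ suc k * (2 * (suc n * suc errors))
      ≤⟨ size-bound 0<n n<M 8≤M 12nk≤2ʳ errors (errors-bound (<⇒≤ n<M) 8≤M (m^n>0 M {{>-nonZero (positive j)}} n) 0<θ (m≤n*m σ T {{>-nonZero (positive (r + j))}})) ⟩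
    M ^ (2 ^ r) * θ
      ≡⟨ cong (_* θ) (∣+∣ᵗ r j) ⟨
    T * θ
      ≡⟨ eighth T ⟩
    L.N ∎
    where
    eighth : ∀ T → T * (T * ((T * T) * (T * T) * (T * T))) ≡ ((T * T) * (T * T)) * ((T * T) * (T * T))
    eighth = solve-∀

-- The constant is 6 * 2 * (2 * 12 * 2) * 8: m is at most n⁶, 2 ^ suc k at most 2 t, rounding 12 n
-- (k + 1) up to a power of two costs 2, k + 1 is at most 2 k, and N is T⁸.
vertex-bound : ∀ n k l r t → 0 < n → 0 < k → ∣ l ∣ᵗ ≤ (n * (n * n)) * (n * (n * n)) → 2 ^ k ≤ t → 2 ^ r ≤ 2 * (12 * (n * suc k)) →
               ∣ 3 + (r + (suc k + l)) ∣ᵗ ≤ n ^ (4608 * n * t * k)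
vertex-bound n k l r t 0<n 0<k m≤n⁶ 2ᵏ≤t 2ʳ≤ = begin
  ∣ 3 + (r + (suc k + l)) ∣ᵗ                            ≡⟨ ∣+∣ᵗ 3 (r + (suc k + l)) ⟩
  ∣ r + (suc k + l) ∣ᵗ ^ 8                              ≡⟨ cong (_^ 8) (∣+∣ᵗ r (suc k + l)) ⟩
  (∣ suc k + l ∣ᵗ ^ 2 ^ r) ^ 8                          ≡⟨ cong (λ x → (x ^ 2 ^ r) ^ 8) (∣+∣ᵗ (suc k) l) ⟩
  ((∣ l ∣ᵗ ^ (2 ^ suc k)) ^ 2 ^ r) ^ 8
    ≤⟨ ^-monoˡ-≤ 8 (^-monoˡ-≤ (2 ^ r) (^-monoˡ-≤ (2 ^ suc k) (≤-trans m≤n⁶ (≤-reflexive (sixth n))))) ⟩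
  (((n ^ 6) ^ (2 ^ suc k)) ^ 2 ^ r) ^ 8                 ≡⟨ collapse ⟩
  n ^ (6 * 2 ^ suc k * 2 ^ r * 8)                       ≤⟨ ^-monoʳ-≤ n {{>-nonZero 0<n}} exponent ⟩
  n ^ (4608 * n * t * k)                                ∎
  where
  open ≤-Reasoning
  sixth : ∀ n → (n * (n * n)) * (n * (n * n)) ≡ n * (n * (n * (n * (n * (n * 1)))))
  sixth = solve-∀
  collapse : (((n ^ 6) ^ (2 ^ suc k)) ^ 2 ^ r) ^ 8 ≡ n ^ (6 * 2 ^ suc k * 2 ^ r * 8)
  collapse = trans (cong (λ x → (x ^ 2 ^ r) ^ 8) (^-*-assoc n 6 (2 ^ suc k)))
    (trans (cong (_^ 8) (^-*-assoc n (6 * 2 ^ suc k) (2 ^ r))) (^-*-assoc n (6 * 2 ^ suc k * 2 ^ r) 8))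
  exponent : 6 * 2 ^ suc k * 2 ^ r * 8 ≤ 4608 * n * t * k
  exponent = begin
    6 * (2 * 2 ^ k) * 2 ^ r * 8
      ≤⟨ *-monoˡ-≤ 8 (*-mono-≤ (*-monoʳ-≤ 6 (*-monoʳ-≤ 2 2ᵏ≤t)) 2ʳ≤) ⟩
    6 * (2 * t) * (2 * (12 * (n * suc k))) * 8
      ≤⟨ *-monoˡ-≤ 8 (*-monoʳ-≤ (6 * (2 * t)) (*-monoʳ-≤ 2 (*-monoʳ-≤ 12 (*-monoʳ-≤ n (+-monoˡ-≤ k 0<k))))) ⟩
    6 * (2 * t) * (2 * (12 * (n * (k + k)))) * 8         ≡⟨ constant n t k ⟩
    4608 * n * t * k                                     ∎
    where
    constant : ∀ n t k → 6 * (2 * t) * (2 * (12 * (n * (k + k)))) * 8 ≡ 4608 * n * t * k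
    constant = solve-∀

-- For n = 1 the bound is 2⁰, so the host can have only one vertex and the general construction does
-- not apply.
one-vertex : ∀ t → RamseyGraph 1 t 1
one-vertex t = complete , (λ χ → true , λ H _ → copy H χ true) , λ H₁ _ _ χ → inj₁ (copy H₁ χ true)
  where
  open Complete {1} {1} (λ _ _ → zero) (λ _ _ → refl)
  no-edge : ∀ (H : EOGraph 1) u v → adj H u v ≢ true
  no-edge H zero zero e = case trans (sym e) (adj-irr H zero) of λ ()
  copy : ∀ H χ c → MonoCopy H complete χ c
  copy H χ c = record
    { f = id ; f-inj = id
    ; f-edge = λ u v e → contradiction e (no-edge H u v)
    ; f-colour = λ u v e → contradiction e (no-edge H u v)
    ; f-order = λ u v _ _ e _ _ → contradiction e (no-edge H u v)
    }

bounded-ramsey-graph : ∀ n t → 1 ≤ n → 2 ≤ t → ∃[ N ] (BoundedBy (4608 * n * t) n t N × RamseyGraph n t N)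
bounded-ramsey-graph (suc zero) t _ 2≤t =
  1 , boundedBy (4608 * 1 * t) 1 t 0 1 (s≤s z≤n) (≤-trans (s≤s z≤n) 2≤t) (≤-reflexive (sym (^-zeroˡ (4608 * 1 * t * 0)))) , one-vertex t
bounded-ramsey-graph n@(suc (suc a)) t 1≤n 2≤t
  with log₂-between t (≤-trans (s≤s z≤n) 2≤t)
     | tower-size-between (n * (n * n)) (*-mono-≤ {1} {n} {2} (s≤s z≤n) (*-mono-≤ {1} {n} {2} (s≤s z≤n) (s≤s (s≤s z≤n))))
-- Since t ≥ 2, the integer logarithm k is positive, as k + 1 ≤ 2 k requires.
... | zero  , _ , t<2 | _ = contradiction t<2 (≤⇒≯ 2≤t)
... | k@(suc _) , 2ᵏ≤t , t<2ᵏ⁺¹ | l , n³≤m , m≤n⁶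
  with log₂-between (12 * (n * suc k)) (s≤s z≤n)
... | e , 2ᵉ≤ , <2ᵉ⁺¹ = _
  -- The index `suc e` gives the smallest power of two above 12 n (k + 1), hence at most twice that
  -- number.
  , boundedBy (4608 * n * t) n t k _ 1≤n 2ᵏ≤t (vertex-bound n k l (suc e) t 1≤n (s≤s z≤n) m≤n⁶ 2ᵏ≤t (*-monoʳ-≤ 2 2ᵉ≤))
  , ramsey-graph n k l (suc e) t (s≤s (s≤s z≤n)) n³≤m (<⇒≤ t<2ᵏ⁺¹) (<⇒≤ <2ᵉ⁺¹)

theorem8 : ∃[ C ] (0 < C × ((n t : ℕ) → 1 ≤ n → 2 ≤ t →
    (∃[ N ] (BoundedBy (C * n * t) n t N × Σ (EOGraph N) λ G → RamseyUniversal G n (F n t)))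
    × ((H₁ H₂ : EOGraph n) → F n t H₂ →
    ∃[ B ] (BoundedBy (C * n * t) n t B × RedgeAtMost H₁ H₂ B))))
theorem8 = 4608 , s≤s z≤n , λ n t 1≤n 2≤t → case bounded-ramsey-graph n t 1≤n 2≤t of λ
  { (N , bound , G , universal , arrows) →
      (N , bound , G , universal) ,
      λ H₁ H₂ H₂∈F → N , bound , N , ≤-refl , G , arrows H₁ H₂ H₂∈F }
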